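{- For any prime $p\geq 5$ and any nonnegative integers $k$, $s$, $$\binom{kp}{sp}_q\equiv\binom{k}{s}_{q^{p^2}}-\binom{k}{s+1}\binom{s+1}{2}\frac{p^2-1}{12}(q^p-1)^2 \pmod{[p]_q^3}.$$
   Context: Here $q$ is an indeterminate. For a nonnegative integer $n$, $[n]_q := 1+q+\cdots+q^{n-1}=\frac{1-q^n}{1-q}$ (so $[0]_q=0$), and $[n]!_q := [n]_q[n-1]_q\cdots[1]_q$ (with $[0]!_q=1$). The $q$-binomial coefficient is $\binom{n}{m}_q := \frac{[n]!_q}{[m]!_q\,[n-m]!_q}$ for $0\le m\le n$, and $\binom{n}{m}_q:=0$ for $m>n$; it is a polynomial in $q$ with integer coefficients. $\binom{n}{m}_{q^{p^2}}$ denotes the polynomial obtained from $\binom{n}{m}_q$ by substituting $q^{p^2}$ for $q$. Binomial coefficients without subscript are the ordinary ones (zero when the lower index exceeds the upper). For polynomials $A,B\in\mathbb{Z}[q]$, $A\equiv B \pmod{[p]_q^3}$ means that $[p]_q^3$ divides $A-B$ in $\mathbb{Z}[q]$; note that $\frac{p^2-1}{12}$ is an integer for every prime $p\ge 5$. -}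

module Defs where

open import Algebra.Bundles using (CommutativeRing; Semiring)
open import Data.Integer.Base as ℤ using (ℤ; 0ℤ; 1ℤ)
import Data.Integer.Properties as ℤₚ
open import Data.List.Base using (List; []; _∷_; map)
open import Data.Maybe.Base using (nothing)
open import Data.Nat.Base as ℕ using (ℕ; zero; suc; _≤_; _<_; _∸_)
import Data.Nat.Properties as ℕₚ
open import Data.Product.Base using (_,_)
open import Level using (0ℓ)
open import Relation.Binary.Bundles using (Setoid)
open import Relation.Binary.PropositionalEquality
  using (_≡_; refl; sym; trans; cong; cong₂; subst; module ≡-Reasoning)
import Relation.Binary.Reasoning.Setoid as SetoidReasoning
open import Relation.Nullary.Decidable using (yes; no)
open import Relation.Nullary.Negation using (contradiction)
open import Tactic.RingSolver using (solve-∀)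
open import Tactic.RingSolver.Core.AlmostCommutativeRing
  using (AlmostCommutativeRing; fromCommutativeRing)

-- Coefficients in order of increasing degree.  Trailing zeros are allowed,
-- so polynomials are compared with _≈_ rather than _≡_.

Poly : Set
Poly = List ℤ

coeff : Poly → ℕ → ℤ
coeff []      _       = 0ℤ
coeff (a ∷ f) zero    = a
coeff (a ∷ f) (suc i) = coeff f i

infix 4 _≈_

record _≈_ (f g : Poly) : Set where
  constructor mk≈
  field at : ∀ i → coeff f i ≡ coeff g i

open _≈_ public

const : ℤ → Poly
const a = a ∷ []

q : Poly
q = 0ℤ ∷ 1ℤ ∷ []

infixl 6 _+_
infixl 7 _*_ _·_
infix  8 -_

_+_ : Poly → Poly → Poly
[]      + g       = g
(a ∷ f) + []      = a ∷ f
(a ∷ f) + (b ∷ g) = (a ℤ.+ b) ∷ (f + g)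

-_ : Poly → Poly
- f = map ℤ.-_ f

_·_ : ℤ → Poly → Poly
a · f = map (a ℤ.*_) f

_*_ : Poly → Poly → Poly
[]      * g = []
(a ∷ f) * g = a · g + (0ℤ ∷ f * g)

≈-refl : ∀ {f} → f ≈ f
≈-refl = mk≈ λ _ → refl

≈-sym : ∀ {f g} → f ≈ g → g ≈ f
≈-sym e = mk≈ λ i → sym (at e i)

≈-trans : ∀ {f g h} → f ≈ g → g ≈ h → f ≈ h
≈-trans d e = mk≈ λ i → trans (at d i) (at e i)

≈-setoid : Setoid 0ℓ 0ℓ
≈-setoid = record
  { Carrier = Poly
  ; _≈_ = _≈_
  ; isEquivalence = record { refl = ≈-refl ; sym = ≈-sym ; trans = ≈-trans }
  }

≈-head : ∀ {a b f g} → (a ∷ f) ≈ (b ∷ g) → a ≡ b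
≈-head e = at e 0

≈-tail : ∀ {a b f g} → (a ∷ f) ≈ (b ∷ g) → f ≈ g
≈-tail e = mk≈ λ i → at e (suc i)

≈-tail₀ : ∀ {a f} → (a ∷ f) ≈ [] → f ≈ []
≈-tail₀ e = mk≈ λ i → at e (suc i)

∷-cong : ∀ {a b f g} → a ≡ b → f ≈ g → (a ∷ f) ≈ (b ∷ g)
∷-cong a≡b f≈g = mk≈ λ where
  zero    → a≡b
  (suc i) → at f≈g i

0∷[]≈[] : (0ℤ ∷ []) ≈ []
0∷[]≈[] = mk≈ λ where
  zero    → refl
  (suc _) → refl

coeff-+ : ∀ f g i → coeff (f + g) i ≡ coeff f i ℤ.+ coeff g i
coeff-+ []      g       i       = sym (ℤₚ.+-identityˡ _)
coeff-+ (a ∷ f) []      i       = sym (ℤₚ.+-identityʳ _)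
coeff-+ (a ∷ f) (b ∷ g) zero    = refl
coeff-+ (a ∷ f) (b ∷ g) (suc i) = coeff-+ f g i

coeff-neg : ∀ f i → coeff (- f) i ≡ ℤ.- coeff f i
coeff-neg []      i       = refl
coeff-neg (a ∷ f) zero    = refl
coeff-neg (a ∷ f) (suc i) = coeff-neg f i

coeff-· : ∀ a f i → coeff (a · f) i ≡ a ℤ.* coeff f i
coeff-· a []      i       = sym (ℤₚ.*-zeroʳ a)
coeff-· a (b ∷ f) zero    = refl
coeff-· a (b ∷ f) (suc i) = coeff-· a f i

+-cong : ∀ {f f′ g g′} → f ≈ f′ → g ≈ g′ → f + g ≈ f′ + g′
+-cong {f} {f′} {g} {g′} d e = mk≈ λ i → begin
  coeff (f + g) i               ≡⟨ coeff-+ f g i ⟩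
  coeff f i ℤ.+ coeff g i       ≡⟨ cong₂ ℤ._+_ (at d i) (at e i) ⟩
  coeff f′ i ℤ.+ coeff g′ i     ≡⟨ coeff-+ f′ g′ i ⟨
  coeff (f′ + g′) i             ∎
  where open ≡-Reasoning

+-comm : ∀ f g → f + g ≈ g + f
+-comm f g = mk≈ λ i → begin
  coeff (f + g) i           ≡⟨ coeff-+ f g i ⟩
  coeff f i ℤ.+ coeff g i   ≡⟨ ℤₚ.+-comm (coeff f i) (coeff g i) ⟩
  coeff g i ℤ.+ coeff f i   ≡⟨ coeff-+ g f i ⟨
  coeff (g + f) i           ∎
  where open ≡-Reasoning

+-assoc : ∀ f g h → (f + g) + h ≈ f + (g + h)
+-assoc f g h = mk≈ λ i → begin
  coeff ((f + g) + h) i                       ≡⟨ coeff-+ (f + g) h i ⟩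
  coeff (f + g) i ℤ.+ coeff h i               ≡⟨ cong (ℤ._+ coeff h i) (coeff-+ f g i) ⟩
  coeff f i ℤ.+ coeff g i ℤ.+ coeff h i       ≡⟨ ℤₚ.+-assoc (coeff f i) (coeff g i) (coeff h i) ⟩
  coeff f i ℤ.+ (coeff g i ℤ.+ coeff h i)     ≡⟨ cong (λ c → coeff f i ℤ.+ c) (coeff-+ g h i) ⟨
  coeff f i ℤ.+ coeff (g + h) i               ≡⟨ coeff-+ f (g + h) i ⟨
  coeff (f + (g + h)) i                       ∎
  where open ≡-Reasoning

+-identityˡ : ∀ f → [] + f ≈ f
+-identityˡ f = ≈-refl

+-identityʳ : ∀ f → f + [] ≈ f
+-identityʳ f = +-comm f []

-‿cong : ∀ {f g} → f ≈ g → - f ≈ - g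
-‿cong {f} {g} e = mk≈ λ i →
  trans (coeff-neg f i) (trans (cong ℤ.-_ (at e i)) (sym (coeff-neg g i)))

-‿inverseʳ : ∀ f → f + - f ≈ []
-‿inverseʳ f = mk≈ λ i → begin
  coeff (f + - f) i               ≡⟨ coeff-+ f (- f) i ⟩
  coeff f i ℤ.+ coeff (- f) i     ≡⟨ cong (λ c → coeff f i ℤ.+ c) (coeff-neg f i) ⟩
  coeff f i ℤ.+ ℤ.- coeff f i     ≡⟨ ℤₚ.+-inverseʳ (coeff f i) ⟩
  0ℤ                              ∎
  where open ≡-Reasoning

-‿inverseˡ : ∀ f → - f + f ≈ []
-‿inverseˡ f = ≈-trans (+-comm (- f) f) (-‿inverseʳ f)

·-cong : ∀ {a b f g} → a ≡ b → f ≈ g → a · f ≈ b · g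
·-cong {a} {b} {f} {g} d e = mk≈ λ i →
  trans (coeff-· a f i) (trans (cong₂ ℤ._*_ d (at e i)) (sym (coeff-· b g i)))

·-zeroˡ : ∀ f → 0ℤ · f ≈ []
·-zeroˡ f = mk≈ λ i → trans (coeff-· 0ℤ f i) (ℤₚ.*-zeroˡ (coeff f i))

·-identityˡ : ∀ f → 1ℤ · f ≈ f
·-identityˡ f = mk≈ λ i → trans (coeff-· 1ℤ f i) (ℤₚ.*-identityˡ (coeff f i))

·-assoc : ∀ a b f → (a ℤ.* b) · f ≈ a · (b · f)
·-assoc a b f = mk≈ λ i → begin
  coeff ((a ℤ.* b) · f) i     ≡⟨ coeff-· (a ℤ.* b) f i ⟩
  a ℤ.* b ℤ.* coeff f i       ≡⟨ ℤₚ.*-assoc a b (coeff f i) ⟩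
  a ℤ.* (b ℤ.* coeff f i)     ≡⟨ cong (a ℤ.*_) (coeff-· b f i) ⟨
  a ℤ.* coeff (b · f) i       ≡⟨ coeff-· a (b · f) i ⟨
  coeff (a · (b · f)) i       ∎
  where open ≡-Reasoning

·-distribˡ-+ : ∀ a f g → a · (f + g) ≈ a · f + a · g
·-distribˡ-+ a f g = mk≈ λ i → begin
  coeff (a · (f + g)) i                      ≡⟨ coeff-· a (f + g) i ⟩
  a ℤ.* coeff (f + g) i                      ≡⟨ cong (a ℤ.*_) (coeff-+ f g i) ⟩
  a ℤ.* (coeff f i ℤ.+ coeff g i)            ≡⟨ ℤₚ.*-distribˡ-+ a (coeff f i) (coeff g i) ⟩
  a ℤ.* coeff f i ℤ.+ a ℤ.* coeff g i        ≡⟨ cong₂ ℤ._+_ (coeff-· a f i) (coeff-· a g i) ⟨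
  coeff (a · f) i ℤ.+ coeff (a · g) i        ≡⟨ coeff-+ (a · f) (a · g) i ⟨
  coeff (a · f + a · g) i                    ∎
  where open ≡-Reasoning

·-distribʳ-+ : ∀ f a b → (a ℤ.+ b) · f ≈ a · f + b · f
·-distribʳ-+ f a b = mk≈ λ i → begin
  coeff ((a ℤ.+ b) · f) i                    ≡⟨ coeff-· (a ℤ.+ b) f i ⟩
  (a ℤ.+ b) ℤ.* coeff f i                    ≡⟨ ℤₚ.*-distribʳ-+ (coeff f i) a b ⟩
  a ℤ.* coeff f i ℤ.+ b ℤ.* coeff f i        ≡⟨ cong₂ ℤ._+_ (coeff-· a f i) (coeff-· b f i) ⟨
  coeff (a · f) i ℤ.+ coeff (b · f) i        ≡⟨ coeff-+ (a · f) (b · f) i ⟨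
  coeff (a · f + b · f) i                    ∎
  where open ≡-Reasoning

+-interchange : ∀ f g h k → (f + g) + (h + k) ≈ (f + h) + (g + k)
+-interchange f g h k = begin
  (f + g) + (h + k)   ≈⟨ +-assoc f g (h + k) ⟩
  f + (g + (h + k))   ≈⟨ +-cong (≈-refl {f}) (+-assoc g h k) ⟨
  f + ((g + h) + k)   ≈⟨ +-cong (≈-refl {f}) (+-cong (+-comm g h) (≈-refl {k})) ⟩
  f + ((h + g) + k)   ≈⟨ +-cong (≈-refl {f}) (+-assoc h g k) ⟩
  f + (h + (g + k))   ≈⟨ +-assoc f h (g + k) ⟨
  (f + h) + (g + k)   ∎
  where open SetoidReasoning ≈-setoid

*-zeroʳ : ∀ f → f * [] ≈ []
*-zeroʳ []      = ≈-refl
*-zeroʳ (a ∷ f) = ≈-trans (∷-cong refl (*-zeroʳ f)) 0∷[]≈[]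

*-≈0ˡ : ∀ {f} g → f ≈ [] → f * g ≈ []
*-≈0ˡ {[]}    g e = ≈-refl
*-≈0ˡ {a ∷ f} g e = +-cong
  (≈-trans (·-cong (at e 0) (≈-refl {g})) (·-zeroˡ g))
  (≈-trans (∷-cong refl (*-≈0ˡ {f} g (≈-tail₀ e))) 0∷[]≈[])

*-congˡ : ∀ f {g h} → g ≈ h → f * g ≈ f * h
*-congˡ []      e = ≈-refl
*-congˡ (a ∷ f) e = +-cong (·-cong {a} refl e) (∷-cong refl (*-congˡ f e))

*-congʳ : ∀ {f g} h → f ≈ g → f * h ≈ g * h
*-congʳ {[]}    {g}     h e = ≈-sym (*-≈0ˡ h (≈-sym e))
*-congʳ {a ∷ f} {[]}    h e = *-≈0ˡ h e
*-congʳ {a ∷ f} {b ∷ g} h e =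
  +-cong (·-cong (≈-head e) (≈-refl {h})) (∷-cong refl (*-congʳ h (≈-tail e)))

*-cong : ∀ {f f′ g g′} → f ≈ f′ → g ≈ g′ → f * g ≈ f′ * g′
*-cong {f′ = f′} {g = g} d e = ≈-trans (*-congʳ g d) (*-congˡ f′ e)

*-∷ʳ : ∀ f b g → f * (b ∷ g) ≈ b · f + (0ℤ ∷ f * g)
*-∷ʳ []      b g = ≈-sym 0∷[]≈[]
*-∷ʳ (a ∷ f) b g = ∷-cong (cong (ℤ._+ 0ℤ) (ℤₚ.*-comm a b)) (begin
  a · g + f * (b ∷ g)               ≈⟨ +-cong (≈-refl {a · g}) (*-∷ʳ f b g) ⟩
  a · g + (b · f + (0ℤ ∷ f * g))    ≈⟨ +-assoc (a · g) (b · f) _ ⟨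
  a · g + b · f + (0ℤ ∷ f * g)      ≈⟨ +-cong (+-comm (a · g) (b · f)) ≈-refl ⟩
  b · f + a · g + (0ℤ ∷ f * g)      ≈⟨ +-assoc (b · f) (a · g) _ ⟩
  b · f + (a · g + (0ℤ ∷ f * g))    ∎)
  where open SetoidReasoning ≈-setoid

*-comm : ∀ f g → f * g ≈ g * f
*-comm []      g = ≈-sym (*-zeroʳ g)
*-comm (a ∷ f) g = ≈-trans
  (+-cong (≈-refl {a · g}) (∷-cong refl (*-comm f g)))
  (≈-sym (*-∷ʳ g a f))

*-distribˡ-+ : ∀ f g h → f * (g + h) ≈ f * g + f * h
*-distribˡ-+ []      g h = ≈-refl
*-distribˡ-+ (a ∷ f) g h = ≈-trans
  (+-cong (·-distribˡ-+ a g h) (∷-cong refl (*-distribˡ-+ f g h)))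
  (+-interchange (a · g) (a · h) (0ℤ ∷ f * g) (0ℤ ∷ f * h))

*-distribʳ-+ : ∀ h f g → (f + g) * h ≈ f * h + g * h
*-distribʳ-+ h f g = ≈-trans (*-comm (f + g) h)
  (≈-trans (*-distribˡ-+ h f g) (+-cong (*-comm h f) (*-comm h g)))

·-*-assoc : ∀ a f g → (a · f) * g ≈ a · (f * g)
·-*-assoc a []      g = ≈-refl
·-*-assoc a (b ∷ f) g = ≈-trans
  (+-cong (·-assoc a b g) (∷-cong (sym (ℤₚ.*-zeroʳ a)) (·-*-assoc a f g)))
  (≈-sym (·-distribˡ-+ a (b · g) (0ℤ ∷ f * g)))

*-assoc : ∀ f g h → (f * g) * h ≈ f * (g * h)
*-assoc []      g h = ≈-refl
*-assoc (a ∷ f) g h = ≈-trans (*-distribʳ-+ h (a · g) (0ℤ ∷ f * g))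
  (+-cong (·-*-assoc a g h)
    (≈-trans (+-cong (·-zeroˡ h) ≈-refl) (∷-cong refl (*-assoc f g h))))

*-identityˡ : ∀ f → const 1ℤ * f ≈ f
*-identityˡ f = ≈-trans (+-cong (·-identityˡ f) 0∷[]≈[]) (+-identityʳ f)

ℤ[q] : CommutativeRing 0ℓ 0ℓ
ℤ[q] = record
  { Carrier = Poly
  ; _≈_ = _≈_
  ; _+_ = _+_
  ; _*_ = _*_
  ; -_  = -_
  ; 0#  = []
  ; 1#  = const 1ℤ
  ; isCommutativeRing = record
    { isRing = record
      { +-isAbelianGroup = record
        { isGroup = record
          { isMonoid = record
            { isSemigroup = record
              { isMagma = record
                { isEquivalence = Setoid.isEquivalence ≈-setoid
                ; ∙-cong = +-cong
                }
              ; assoc = +-assoc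
              }
            ; identity = +-identityˡ , +-identityʳ
            }
          ; inverse = -‿inverseˡ , -‿inverseʳ
          ; ⁻¹-cong = -‿cong
          }
        ; comm = +-comm
        }
      ; *-cong = *-cong
      ; *-assoc = *-assoc
      ; *-identity = *-identityˡ , λ f → ≈-trans (*-comm f (const 1ℤ)) (*-identityˡ f)
      ; distrib = *-distribˡ-+ , *-distribʳ-+
      }
    ; *-comm = *-comm
    }
  }

open CommutativeRing ℤ[q] public using (_-_; 0#; 1#)
open import Algebra.Definitions.RawSemiring (Semiring.rawSemiring (CommutativeRing.semiring ℤ[q])) public
  using (_^_; _∣_)
open import Algebra.Definitions.RawMagma (Semiring.*-rawMagma (CommutativeRing.semiring ℤ[q]))
  using (_,_; module _∣ʳ_)

infix 4 _≡_[mod_]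

_≡_[mod_] : Poly → Poly → Poly → Set
f ≡ g [mod m ] = m ∣ f - g

-- f [q↦ g ] is f(g(q)), by Horner's rule.

infix 9 _[q↦_]

_[q↦_] : Poly → Poly → Poly
[]      [q↦ g ] = 0#
(a ∷ f) [q↦ g ] = const a + g * (f [q↦ g ])

[_]q : ℕ → Poly
[ zero  ]q = 0#
[ suc n ]q = [ n ]q + q ^ n

[_]!q : ℕ → Poly
[ zero  ]!q = 1#
[ suc n ]!q = [ suc n ]q * [ n ]!q

private
  solverRing : AlmostCommutativeRing 0ℓ 0ℓ
  solverRing = fromCommutativeRing ℤ[q] λ _ → nothing

  module Solver where
    shift : ∀ x n y z → x + (n + y * z) ≈ (x + n) + y * z
    shift = solve-∀ solverRing

    -‿distrib : ∀ b c d → (b + - c) * d ≈ b * d + - (c * d)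
    -‿distrib = solve-∀ solverRing

    pascal : ∀ x y u v w c d →
             (c + w * d) * ((x * u) * (y * v)) ≈
             x * (c * (u * (y * v))) + (w * y) * (d * ((x * u) * v))
    pascal = solve-∀ solverRing

    factor : ∀ x y w f → x * f + (w * y) * f ≈ (x + w * y) * f
    factor = solve-∀ solverRing

    +-*-assoc : ∀ x w y z → x + w * y + w * z ≈ x + w * (y + z)
    +-*-assoc = solve-∀ solverRing

q^-+ : ∀ m n → q ^ (m ℕ.+ n) ≈ q ^ m * q ^ n
q^-+ zero    n = ≈-sym (*-identityˡ (q ^ n))
q^-+ (suc m) n = ≈-trans (*-congˡ q (q^-+ m n)) (≈-sym (*-assoc q (q ^ m) (q ^ n)))

[+]q : ∀ m n → [ m ℕ.+ n ]q ≈ [ m ]q + q ^ m * [ n ]q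
[+]q m zero rewrite ℕₚ.+-identityʳ m =
  ≈-sym (≈-trans (+-cong (≈-refl {[ m ]q}) (*-zeroʳ (q ^ m))) (+-identityʳ [ m ]q))
[+]q m (suc n) rewrite ℕₚ.+-suc m n =
  ≈-trans (+-cong ([+]q m n) (q^-+ m n)) (Solver.+-*-assoc [ m ]q (q ^ m) [ n ]q (q ^ n))

!*!∣[+]! : ∀ m n → [ m ]!q * [ n ]!q ∣ [ m ℕ.+ n ]!q
!*!∣[+]! zero n = 1# ,
  ≈-trans (*-identityˡ (1# * [ n ]!q)) (*-identityˡ [ n ]!q)
!*!∣[+]! (suc m) zero rewrite ℕₚ.+-identityʳ m = 1# ,
  ≈-trans (*-identityˡ ([ suc m ]!q * 1#))
    (≈-trans (*-comm [ suc m ]!q 1#) (*-identityˡ [ suc m ]!q))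
!*!∣[+]! (suc m) (suc n) with !*!∣[+]! m (suc n) | !*!∣[+]! (suc m) n
... | c , ceq | d , deq rewrite ℕₚ.+-suc m n = (c + w * d) , (begin
  (c + w * d) * ((x * u) * (y * v))
    ≈⟨ Solver.pascal x y u v w c d ⟩
  x * (c * (u * (y * v))) + (w * y) * (d * ((x * u) * v))
    ≈⟨ +-cong (*-congˡ x ceq) (*-congˡ (w * y) deq) ⟩
  x * F + (w * y) * F
    ≈⟨ Solver.factor x y w F ⟩
  (x + w * y) * F
    ≈⟨ *-congʳ F ([+]q (suc m) (suc n)) ⟨
  [ suc m ℕ.+ suc n ]q * F
    ≡⟨ cong (λ t → [ suc t ]q * F) (ℕₚ.+-suc m n) ⟩
  [ suc (suc (m ℕ.+ n)) ]q * F ∎)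
  where
  open SetoidReasoning ≈-setoid
  x = [ suc m ]q
  y = [ suc n ]q
  u = [ m ]!q
  v = [ n ]!q
  w = q ^ suc m
  F = [ suc (m ℕ.+ n) ]!q

!*!∣! : ∀ {m n} → m ≤ n → [ m ]!q * [ n ∸ m ]!q ∣ [ n ]!q
!*!∣! {m} {n} m≤n =
  subst (λ t → [ m ]!q * [ n ∸ m ]!q ∣ [ t ]!q) (ℕₚ.m+[n∸m]≡n m≤n) (!*!∣[+]! m (n ∸ m))

-- The quotient [n]! / ([m]! [n-m]!), which is unique by qbinom-unique below.

qbinom : ℕ → ℕ → Poly
qbinom n m with m ℕₚ.≤? n
... | yes m≤n = _∣ʳ_.quotient (!*!∣! m≤n)
... | no  _   = 0#

qbinom-quotient : ∀ {n m} → m ≤ n → qbinom n m * ([ m ]!q * [ n ∸ m ]!q) ≈ [ n ]!q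
qbinom-quotient {n} {m} m≤n with m ℕₚ.≤? n
... | yes le = _∣ʳ_.equality (!*!∣! le)
... | no  gt = contradiction m≤n gt

coeff₀-* : ∀ f g → coeff (f * g) 0 ≡ coeff f 0 ℤ.* coeff g 0
coeff₀-* []      g = sym (ℤₚ.*-zeroˡ (coeff g 0))
coeff₀-* (a ∷ f) g = begin
  coeff (a · g + (0ℤ ∷ f * g)) 0    ≡⟨ coeff-+ (a · g) (0ℤ ∷ f * g) 0 ⟩
  coeff (a · g) 0 ℤ.+ 0ℤ            ≡⟨ ℤₚ.+-identityʳ _ ⟩
  coeff (a · g) 0                   ≡⟨ coeff-· a g 0 ⟩
  a ℤ.* coeff g 0                   ∎
  where open ≡-Reasoning

coeff₀-[]q : ∀ n → coeff [ suc n ]q 0 ≡ 1ℤ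
coeff₀-[]q zero    = refl
coeff₀-[]q (suc n) = begin
  coeff ([ suc n ]q + q ^ suc n) 0                ≡⟨ coeff-+ [ suc n ]q (q ^ suc n) 0 ⟩
  coeff [ suc n ]q 0 ℤ.+ coeff (q ^ suc n) 0      ≡⟨ cong₂ ℤ._+_ (coeff₀-[]q n) (coeff₀-* q (q ^ n)) ⟩
  1ℤ ℤ.+ 0ℤ ℤ.* coeff (q ^ n) 0                   ≡⟨ cong (λ c → 1ℤ ℤ.+ c) (ℤₚ.*-zeroˡ (coeff (q ^ n) 0)) ⟩
  1ℤ                                              ∎
  where open ≡-Reasoning

coeff₀-!q : ∀ n → coeff [ n ]!q 0 ≡ 1ℤ
coeff₀-!q zero    = refl
coeff₀-!q (suc n) = trans (coeff₀-* [ suc n ]q [ n ]!q)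
  (cong₂ ℤ._*_ (coeff₀-[]q n) (coeff₀-!q n))

*≈0⇒≈0 : ∀ f {g} → coeff g 0 ≡ 1ℤ → f * g ≈ 0# → f ≈ 0#
*≈0⇒≈0 []      g₀≡1 e = ≈-refl
*≈0⇒≈0 (a ∷ f) {g} g₀≡1 e = ≈-trans (∷-cong a≡0 (*≈0⇒≈0 f g₀≡1 fg≈0)) 0∷[]≈[]
  where
  a≡0 : a ≡ 0ℤ
  a≡0 = begin
    a                            ≡⟨ ℤₚ.*-identityʳ a ⟨
    a ℤ.* 1ℤ                     ≡⟨ cong (a ℤ.*_) g₀≡1 ⟨
    a ℤ.* coeff g 0              ≡⟨ coeff₀-* (a ∷ f) g ⟨
    coeff ((a ∷ f) * g) 0        ≡⟨ at e 0 ⟩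
    0ℤ                           ∎
    where open ≡-Reasoning
  fg≈0 : f * g ≈ 0#
  fg≈0 = ≈-tail₀ {0ℤ} (begin
    0ℤ ∷ f * g                   ≈⟨ +-cong (·-zeroˡ g) ≈-refl ⟨
    0ℤ · g + (0ℤ ∷ f * g)        ≈⟨ +-cong (·-cong a≡0 (≈-refl {g})) ≈-refl ⟨
    (a ∷ f) * g                  ≈⟨ e ⟩
    0#                           ∎)
    where open SetoidReasoning ≈-setoid

-- [m]! [n-m]! has constant coefficient 1, so it can be cancelled.

qbinom-unique : ∀ {n m} → m ≤ n → ∀ b → b * ([ m ]!q * [ n ∸ m ]!q) ≈ [ n ]!q →
                b ≈ qbinom n m
qbinom-unique {n} {m} m≤n b e = x∙y⁻¹≈ε⇒x≈y b c (*≈0⇒≈0 (b - c) d₀≡1 (begin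
  (b - c) * d     ≈⟨ Solver.-‿distrib b c d ⟩
  b * d - c * d   ≈⟨ x≈y⇒x∙y⁻¹≈ε (≈-trans e (≈-sym (qbinom-quotient m≤n))) ⟩
  0#              ∎))
  where
  open SetoidReasoning ≈-setoid
  open import Algebra.Properties.Group (CommutativeRing.+-group ℤ[q])
  c = qbinom n m
  d = [ m ]!q * [ n ∸ m ]!q
  d₀≡1 : coeff d 0 ≡ 1ℤ
  d₀≡1 = trans (coeff₀-* [ m ]!q [ n ∸ m ]!q)
    (cong₂ ℤ._*_ (coeff₀-!q m) (coeff₀-!q (n ∸ m)))

qbinom-zero : ∀ {n m} → n < m → qbinom n m ≈ 0#
qbinom-zero {n} {m} n<m with m ℕₚ.≤? n
... | yes m≤n = contradiction m≤n (ℕₚ.<⇒≱ n<m)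
... | no  _   = ≈-refl

{-# OPTIONS --safe #-}
module Submission where

-- Put Q = q^p, t = Q - 1 and p = 2m + 1.  Grouping the factors of [kp]! into
-- blocks of p expresses binom(kp, sp) through the products
-- K_j = ∏_{0<i<p} (Q^j - q^i), which are, up to the factor Q^m, the products
-- of the factors 1 - q^l with (j-1)p < l < jp.  Expand K_j in powers of
-- Q^j - 1, a multiple of t, up to the second order, modulo [p]³:
--
-- * modulo [p], ∏_{0<i<p} (x - q^i) ≡ 1 + x + ⋯ + x^{p-1}, so the constant and
--   the quadratic coefficient are ≡ p and ≡ C(p,3);
-- * the linear coefficient then follows from the known ratio K_1 = Q^m K_0′,
--   K_0′ = ∏_{0<i<p} (1 - q^i) being the constant coefficient.
--
-- Comparing Taylor polynomials in t, where t³ ≡ 0, gives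
-- [j]_Q K_j ≡ K_0′ Q^m [j]_{Q^p} (1 - a (j-1) t²) with a = (p²-1)/24.
-- Multiplying over j, everything but binom(k, s) at Q^p and the factor
-- 1 - a s (k-s) t² cancels, since a polynomial congruent to a nonzero integer
-- modulo [p] is not a zero divisor modulo [p]³.

open import Defs
open import Algebra.Bundles using (CommutativeRing; Semiring)
open import Algebra.Definitions.RawMagma (Semiring.*-rawMagma (CommutativeRing.semiring ℤ[q])) using (_,_)
open import Algebra.Properties.Semiring.Exp (CommutativeRing.semiring ℤ[q]) using (^-homo-*; ^-assocʳ)
open import Data.Integer.Base as ℤ using (ℤ; +_; 0ℤ; 1ℤ)
import Data.Integer.Properties as ℤₚ
import Data.Integer.Tactic.RingSolver as ℤSolver
open import Data.List.Base using ([]; _∷_)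
open import Data.Maybe.Base using (Maybe; just; nothing; map)
open import Data.Nat.Base as ℕ using (ℕ; zero; suc; _<_; _≤_; _∸_; _/_; s≤s; z≤n; _!)
open import Data.Nat.Combinatorics using (_C_; nCk≡n!/k![n-k]!; k![n∸k]!∣n!; k>n⇒nCk≡0)
open import Data.Nat.Coprimality using (Coprime; coprime-Bézout; prime⇒coprime)
open import Data.Nat.Divisibility as ℕ∣ using (divides)
open import Data.Nat.DivMod using (m/n*n≡m; m*n/n≡m; m≡m%n+[m/n]*n; m%n<n)
open import Data.Nat.GCD using (module Bézout)
open import Data.Nat.Primality using (Prime; prime⇒irreducible; prime⇒nonZero)
import Data.Nat.Properties as ℕₚ
import Data.Nat.Tactic.RingSolver as ℕSolver
open import Data.Product.Base as × using (∃)
open import Data.Sum.Base using (inj₁; inj₂; [_,_]′)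
open import Level using (0ℓ)
open import Relation.Binary.Bundles using (Setoid)
open import Relation.Binary.PropositionalEquality
  using (_≡_; refl; sym; trans; cong; cong₂; subst; module ≡-Reasoning)
import Relation.Binary.Reasoning.Setoid as SetoidReasoning
open import Relation.Nullary.Negation using (contradiction; ¬_)
open import Tactic.RingSolver using (solve-∀)
open import Tactic.RingSolver.Core.AlmostCommutativeRing
  using (AlmostCommutativeRing; fromCommutativeRing)

-- The obstacle is precision. The quadratic coefficient of K_j stands in front of t², which [p]²
-- divides, so its residue modulo [p] is enough. The linear coefficient is needed modulo [p]² and
-- the constant one modulo [p]³, and there the reduction of ∏ (x - q^i) modulo [p] says too little.
-- So the constant coefficient stays an unknown common factor that cancels in the end, and reversing
-- the factors of K_1 supplies the linear one. Pulling this factor out of the quadratic term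
-- requires C(p,3) = γ p with an integer γ, which exists because 3 does not divide p. What remains
-- is built from Q = 1 + t and integers, so it can be compared through three integer coefficients;
-- equality of those of t² forces the value of a. The product over j ≤ l turns 1 - a (j-1) t² into 1
-- - a C(l,2) t², and C(s+r,2) - C(s,2) - C(r,2) = s r leaves the factor with r = k - s. The stated
-- coefficient arises from (s+1) C(k,s+1) = (k-s) C(k,s) and (p²-1)/12 = 2a.

-- The zero test for the ring solver: `const 0ℤ` and `0#` are different lists, and goals that mix
-- them need the solver to recognise a list of zeros as zero.
0≈? : ∀ f → Maybe (0# ≈ f)
0≈? []      = just ≈-refl
0≈? (+ 0 ∷ f) = map (λ e → ≈-trans (≈-sym 0∷[]≈[]) (∷-cong refl e)) (0≈? f)
0≈? (_ ∷ f) = nothing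

polyRing : AlmostCommutativeRing 0ℓ 0ℓ
polyRing = fromCommutativeRing ℤ[q] 0≈?

-- Congruences modulo a polynomial

module Congruence (m : Poly) where

  infix 4 _≋_

  -- Stored as an equation for `f` instead of divisibility of `f - g`, so that quotients combine by
  -- substitution; a record, so that both sides can be inferred.
  record _≋_ (f g : Poly) : Set where
    constructor mk≋
    field
      quotient : Poly
      equality : f ≈ g + quotient * m

  private
    module Solver where
      refl≋ : ∀ f m → f ≈ f + const 0ℤ * m
      refl≋ = solve-∀ polyRing
      sym≋ : ∀ g c m → g ≈ (g + c * m) + (- c) * m
      sym≋ = solve-∀ polyRing
      trans≋ : ∀ h c d m → (h + d * m) + c * m ≈ h + (c + d) * m
      trans≋ = solve-∀ polyRing
      +≋ : ∀ f g c d m → (f + c * m) + (g + d * m) ≈ (f + g) + (c + d) * m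
      +≋ = solve-∀ polyRing
      *≋ : ∀ f g c d m → (f + c * m) * (g + d * m) ≈ f * g + (f * d + c * g + c * d * m) * m
      *≋ = solve-∀ polyRing
      neg≋ : ∀ f c m → - (f + c * m) ≈ - f + (- c) * m
      neg≋ = solve-∀ polyRing
      diff : ∀ g c m → c * m ≈ (g + c * m) + - g
      diff = solve-∀ polyRing
      undiff : ∀ f g → f ≈ g + (f + - g)
      undiff = solve-∀ polyRing

  ≈⇒≋ : ∀ {f g} → f ≈ g → f ≋ g
  ≈⇒≋ {g = g} e = mk≋ (const 0ℤ) (≈-trans e (Solver.refl≋ g m))

  ≋-refl : ∀ {f} → f ≋ f
  ≋-refl = ≈⇒≋ ≈-refl

  ≋-sym : ∀ {f g} → f ≋ g → g ≋ f
  ≋-sym {f} {g} (mk≋ c e) =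
    mk≋ (- c) (≈-trans (Solver.sym≋ g c m) (+-cong (≈-sym e) ≈-refl))

  ≋-trans : ∀ {f g h} → f ≋ g → g ≋ h → f ≋ h
  ≋-trans {h = h} (mk≋ c e) (mk≋ d e′) =
    mk≋ (c + d) (≈-trans e (≈-trans (+-cong e′ ≈-refl) (Solver.trans≋ h c d m)))

  ≋-setoid : Setoid 0ℓ 0ℓ
  ≋-setoid = record
    { Carrier = Poly
    ; _≈_ = _≋_
    ; isEquivalence = record { refl = ≋-refl ; sym = ≋-sym ; trans = ≋-trans }
    }

  ≋-+ : ∀ {f f′ g g′} → f ≋ f′ → g ≋ g′ → f + g ≋ f′ + g′
  ≋-+ {f′ = f} {g′ = g} (mk≋ c e) (mk≋ d e′) =
    mk≋ (c + d) (≈-trans (+-cong e e′) (Solver.+≋ f g c d m))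

  ≋-* : ∀ {f f′ g g′} → f ≋ f′ → g ≋ g′ → f * g ≋ f′ * g′
  ≋-* {f′ = f} {g′ = g} (mk≋ c e) (mk≋ d e′) =
    mk≋ (f * d + c * g + c * d * m) (≈-trans (*-cong e e′) (Solver.*≋ f g c d m))

  ≋-+ˡ : ∀ f {g g′} → g ≋ g′ → f + g ≋ f + g′
  ≋-+ˡ f e = ≋-+ (≋-refl {f}) e

  ≋-+ʳ : ∀ h {f f′} → f ≋ f′ → f + h ≋ f′ + h
  ≋-+ʳ h e = ≋-+ e (≋-refl {h})

  ≋-*ˡ : ∀ f {g g′} → g ≋ g′ → f * g ≋ f * g′
  ≋-*ˡ f e = ≋-* (≋-refl {f}) e

  ≋-*ʳ : ∀ h {f f′} → f ≋ f′ → f * h ≋ f′ * h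
  ≋-*ʳ h e = ≋-* e (≋-refl {h})

  ≋-neg : ∀ {f g} → f ≋ g → - f ≋ - g
  ≋-neg {g = g} (mk≋ c e) = mk≋ (- c) (≈-trans (-‿cong e) (Solver.neg≋ g c m))

  ≋-^ : ∀ {f g} n → f ≋ g → f ^ n ≋ g ^ n
  ≋-^ zero    e = ≋-refl
  ≋-^ (suc n) e = ≋-* e (≋-^ n e)

  ∣⇒≋0 : ∀ {f} → m ∣ f → f ≋ 0#
  ∣⇒≋0 (c , e) = mk≋ c (≈-sym e)

  ≋⇒∣ : ∀ {f g} → f ≋ g → m ∣ f - g
  ≋⇒∣ {f} {g} (mk≋ c e) = c , ≈-trans (Solver.diff g c m) (+-cong (≈-sym e) ≈-refl)

  ∣⇒≋ : ∀ {f g} → m ∣ f - g → f ≋ g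
  ∣⇒≋ {f} {g} (c , e) = mk≋ c (≈-trans (Solver.undiff f g) (+-cong (≈-refl {g}) (≈-sym e)))

-- Integer constants and cancellation

const-+ : ∀ a b → const (a ℤ.+ b) ≈ const a + const b
const-+ a b = ≈-refl

const-* : ∀ a b → const (a ℤ.* b) ≈ const a * const b
const-* a b = ∷-cong (sym (ℤₚ.+-identityʳ _)) ≈-refl

·≈const* : ∀ a f → a · f ≈ const a * f
·≈const* a f = ≈-sym (≈-trans (+-cong (≈-refl {a · f}) 0∷[]≈[]) (+-identityʳ (a · f)))

*-cancelʳ : ∀ {g} → coeff g 0 ≡ 1ℤ → ∀ a b → a * g ≈ b * g → a ≈ b
*-cancelʳ {g} g₀≡1 a b e = begin
  a           ≈⟨ Solver.split a b ⟩
  b + (a + - b) ≈⟨ +-cong (≈-refl {b}) (*≈0⇒≈0 (a + - b) g₀≡1 (begin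
    (a + - b) * g      ≈⟨ Solver.distrib a b g ⟩
    a * g + - (b * g)  ≈⟨ +-cong e ≈-refl ⟩
    b * g + - (b * g)  ≈⟨ -‿inverseʳ (b * g) ⟩
    0#                 ∎)) ⟩
  b + 0#      ≈⟨ +-identityʳ b ⟩
  b           ∎
  where
  open SetoidReasoning ≈-setoid
  module Solver where
    split : ∀ a b → a ≈ b + (a + - b)
    split = solve-∀ polyRing
    distrib : ∀ a b g → (a + - b) * g ≈ a * g + - (b * g)
    distrib = solve-∀ polyRing

-- As g has constant coefficient 1, the coefficients of b can be read off b g
-- one after the other.

*-divisible : ∀ n {g} → coeff g 0 ≡ 1ℤ → ∀ b a → b * g ≈ n · a → ∃ λ c → b ≈ n · c
*-divisible n         g₀≡1 []       a e = [] ×., ≈-refl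
*-divisible n {g} g₀≡1 (b₀ ∷ b) a e with a₀ ← coeff a 0 in a₀≡ = let
  c ×., b≈nc = *-divisible n g₀≡1 b (tail (a + - (a₀ · g))) b*g≈
  in (a₀ ∷ c) ×., ∷-cong b₀≡ b≈nc
  where
  open ≡-Reasoning
  tail : Poly → Poly
  tail []      = []
  tail (_ ∷ f) = f
  coeff-tail : ∀ f i → coeff (tail f) i ≡ coeff f (suc i)
  coeff-tail []      i = refl
  coeff-tail (x ∷ f) i = refl
  b₀≡ : b₀ ≡ n ℤ.* a₀
  b₀≡ = begin
    b₀                        ≡⟨ ℤₚ.*-identityʳ b₀ ⟨
    b₀ ℤ.* 1ℤ                 ≡⟨ cong (b₀ ℤ.*_) g₀≡1 ⟨
    b₀ ℤ.* coeff g 0          ≡⟨ coeff₀-* (b₀ ∷ b) g ⟨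
    coeff ((b₀ ∷ b) * g) 0    ≡⟨ at e 0 ⟩
    coeff (n · a) 0           ≡⟨ coeff-· n a 0 ⟩
    n ℤ.* coeff a 0           ≡⟨ cong (n ℤ.*_) a₀≡ ⟩
    n ℤ.* a₀                  ∎
  move : ∀ {x y z} → x ℤ.+ y ≡ z → y ≡ z ℤ.+ ℤ.- x
  move {x} {y} refl = sym (trans (cong (ℤ._+ ℤ.- x) (ℤₚ.+-comm x y))
    (trans (ℤₚ.+-assoc y x (ℤ.- x)) (trans (cong (λ w → y ℤ.+ w) (ℤₚ.+-inverseʳ x)) (ℤₚ.+-identityʳ y))))
  b*g≈ : b * g ≈ n · tail (a + - (a₀ · g))
  b*g≈ = mk≈ λ i → begin
    coeff (b * g) i
      ≡⟨ move (trans (sym (coeff-+ (b₀ · g) (0ℤ ∷ b * g) (suc i))) (at e (suc i))) ⟩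
    coeff (n · a) (suc i) ℤ.+ ℤ.- coeff (b₀ · g) (suc i)
      ≡⟨ cong₂ (λ x y → x ℤ.+ ℤ.- y) (coeff-· n a (suc i))
           (trans (coeff-· b₀ g (suc i)) (trans (cong (ℤ._* coeff g (suc i)) b₀≡)
             (trans (ℤₚ.*-assoc n a₀ _) (cong (n ℤ.*_) (sym (coeff-· a₀ g (suc i))))))) ⟩
    n ℤ.* coeff a (suc i) ℤ.+ ℤ.- (n ℤ.* coeff (a₀ · g) (suc i))
      ≡⟨ cong (λ x → n ℤ.* coeff a (suc i) ℤ.+ x) (ℤₚ.neg-distribʳ-* n _) ⟩
    n ℤ.* coeff a (suc i) ℤ.+ n ℤ.* ℤ.- coeff (a₀ · g) (suc i)
      ≡⟨ ℤₚ.*-distribˡ-+ n _ _ ⟨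
    n ℤ.* (coeff a (suc i) ℤ.+ ℤ.- coeff (a₀ · g) (suc i))
      ≡⟨ cong (λ x → n ℤ.* (coeff a (suc i) ℤ.+ x)) (coeff-neg (a₀ · g) (suc i)) ⟨
    n ℤ.* (coeff a (suc i) ℤ.+ coeff (- (a₀ · g)) (suc i))
      ≡⟨ cong (n ℤ.*_) (coeff-+ a (- (a₀ · g)) (suc i)) ⟨
    n ℤ.* coeff (a + - (a₀ · g)) (suc i)
      ≡⟨ cong (n ℤ.*_) (coeff-tail (a + - (a₀ · g)) i) ⟨
    n ℤ.* coeff (tail (a + - (a₀ · g))) i
      ≡⟨ coeff-· n (tail (a + - (a₀ · g))) i ⟨
    coeff (n · tail (a + - (a₀ · g))) i ∎

·-cancel : ∀ n .{{_ : ℤ.NonZero n}} {f g} → n · f ≈ n · g → f ≈ g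
·-cancel n {f} {g} e = mk≈ λ i → ℤₚ.*-cancelˡ-≡ n _ _
  (trans (sym (coeff-· n f i)) (trans (at e i) (coeff-· n g i)))

-- Non-zero-divisors modulo a polynomial

-- `g` is a non-zero-divisor in ℤ[q]/(φ). Invertibility would be too strong: the factors to be
-- cancelled later are congruent to integers such as p and l!, which are in general not units modulo
-- [p].
record Regular (φ g : Poly) : Set where
  constructor mkRegular
  field cancel : ∀ a → φ ∣ g * a → φ ∣ a

open Regular

∣-resp : ∀ {m f g} → f ≈ g → m ∣ f → m ∣ g
∣-resp f≈g (c , e) = c , ≈-trans e f≈g

regular-1 : ∀ {φ} → Regular φ 1#
regular-1 = mkRegular λ a → ∣-resp (*-identityˡ a)

-- If n a = b φ, the constant coefficient 1 of φ forces n to divide every coefficient of b, and then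
-- n cancels in ℤ[q].
regular-const : ∀ {φ} → coeff φ 0 ≡ 1ℤ → ∀ n .{{_ : ℤ.NonZero n}} → Regular φ (const n)
regular-const {φ} φ₀≡1 n = mkRegular λ where
    a (b , e) → let c ×., b≈nc = *-divisible n φ₀≡1 b a (≈-trans e (≈-sym (·≈const* n a))) in
      c , ·-cancel n (begin
        n · (c * φ)   ≈⟨ ·-*-assoc n c φ ⟨
        n · c * φ     ≈⟨ *-congʳ φ b≈nc ⟨
        b * φ         ≈⟨ e ⟩
        const n * a   ≈⟨ ·≈const* n a ⟨
        n · a         ∎)
  where open SetoidReasoning ≈-setoid

regular-* : ∀ {φ f g} → Regular φ f → Regular φ g → Regular φ (f * g)
regular-* {f = f} {g} rf rg = mkRegular λ a d →
  cancel rg a (cancel rf (g * a) (∣-resp (*-assoc f g a) d))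

-- A divisibility of g a may be multiplied by f. This passes regularity from a known product to its
-- factors: from 1 to units, and from p to q - 1.
regular-factorʳ : ∀ {φ} f g → Regular φ (f * g) → Regular φ g
regular-factorʳ f g r = mkRegular λ where
    a (c , e) → cancel r a (f * c , ≈-trans (*-assoc f c _) (≈-trans (*-congˡ f e) (≈-sym (*-assoc f g a))))

module _ {φ : Poly} where
  open Congruence φ

  regular-resp : ∀ {f g} → f ≋ g → Regular φ f → Regular φ g
  regular-resp {f} {g} (mk≋ c e) r = mkRegular λ where
      a (d , e′) → cancel r a (d + c * a , (begin
        (d + c * a) * φ          ≈⟨ Solver.expand d c a φ ⟩
        d * φ + c * φ * a        ≈⟨ +-cong e′ ≈-refl ⟩
        g * a + c * φ * a        ≈⟨ *-distribʳ-+ a g (c * φ) ⟨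
        (g + c * φ) * a          ≈⟨ *-congʳ a e ⟨
        f * a                    ∎))
    where
    open SetoidReasoning ≈-setoid
    module Solver where
      expand : ∀ d c a m → (d + c * a) * m ≈ d * m + c * m * a
      expand = solve-∀ polyRing

  regular-unit : ∀ f g → f * g ≋ 1# → Regular φ f
  regular-unit f g e = regular-factorʳ g f
    (regular-resp (≋-trans (≋-sym e) (≈⇒≋ (*-comm f g))) regular-1)

  regular-cancel : ∀ {g} → Regular φ g → ∀ a b → g * a ≋ g * b → a ≋ b
  regular-cancel {g} r a b e =
    ∣⇒≋ (cancel r (a + - b) (∣-resp (≈-sym (Solver.distrib g a b)) (≋⇒∣ e)))
    where
    module Solver where
      distrib : ∀ g a b → g * (a + - b) ≈ g * a + - (g * b)
      distrib = solve-∀ polyRing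

-- One factor φ is removed at a time: if φ^(e+1) divides g a, then a = a′ φ by regularity modulo φ,
-- and cancelling φ in ℤ[q] leaves φ^e dividing g a′. It lifts all cancellations from [p] to [p]³.
regular-^ : ∀ {φ g} → coeff φ 0 ≡ 1ℤ → Regular φ g → ∀ e → Regular (φ ^ e) g
regular-^         φ₀≡1 r zero    = mkRegular λ a _ → a , ≈-trans (*-comm a 1#) (*-identityˡ a)
regular-^ {φ} {g} φ₀≡1 r (suc e) = mkRegular λ where
    a (c , c≈) → let
      a′ , a′φ≈a = cancel r a (c * φ ^ e , ≈-trans (Solver.shuffle c φ (φ ^ e)) c≈)
      d , d≈ = cancel (regular-^ φ₀≡1 r e) a′ (c , *-cancelʳ φ₀≡1 (c * φ ^ e) (g * a′) (begin
        c * φ ^ e * φ      ≈⟨ Solver.shuffle c φ (φ ^ e) ⟩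
        c * (φ * φ ^ e)    ≈⟨ c≈ ⟩
        g * a              ≈⟨ *-congˡ g a′φ≈a ⟨
        g * (a′ * φ)       ≈⟨ *-assoc g a′ φ ⟨
        g * a′ * φ         ∎))
      in d , (begin
        d * (φ * φ ^ e)    ≈⟨ Solver.shuffle d φ (φ ^ e) ⟨
        d * φ ^ e * φ      ≈⟨ *-congʳ φ d≈ ⟩
        a′ * φ             ≈⟨ a′φ≈a ⟩
        a                  ∎)
  where
  open SetoidReasoning ≈-setoid
  module Solver where
    shuffle : ∀ c x y → c * y * x ≈ c * (x * y)
    shuffle = solve-∀ polyRing

-- Geometric sums

geo : Poly → ℕ → Poly
geo x zero    = 0#
geo x (suc n) = geo x n + x ^ n

[]q≡geo : ∀ n → [ n ]q ≡ geo q n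
[]q≡geo zero    = refl
[]q≡geo (suc n) = cong (_+ q ^ n) ([]q≡geo n)

geo-telescope : ∀ x n → x ^ n ≈ 1# + (x + - 1#) * geo x n
geo-telescope x zero    = Solver.base x
  where
  module Solver where
    base : ∀ x → 1# ≈ 1# + (x + - 1#) * 0#
    base = solve-∀ polyRing
geo-telescope x (suc n) = begin
  x * x ^ n                                    ≈⟨ Solver.split x (x ^ n) ⟩
  x ^ n + (x + - 1#) * x ^ n                   ≈⟨ +-cong (geo-telescope x n) ≈-refl ⟩
  1# + (x + - 1#) * geo x n + (x + - 1#) * x ^ n ≈⟨ Solver.join x (geo x n) (x ^ n) ⟩
  1# + (x + - 1#) * (geo x n + x ^ n)          ∎
  where
  open SetoidReasoning ≈-setoid
  module Solver where
    split : ∀ x y → x * y ≈ y + (x + - 1#) * y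
    split = solve-∀ polyRing
    join : ∀ x g y → 1# + (x + - 1#) * g + (x + - 1#) * y ≈ 1# + (x + - 1#) * (g + y)
    join = solve-∀ polyRing

geo-+ : ∀ x m n → geo x (m ℕ.+ n) ≈ geo x m + x ^ m * geo x n
geo-+ x m zero    rewrite ℕₚ.+-identityʳ m =
  ≈-sym (≈-trans (+-cong (≈-refl {geo x m}) (*-zeroʳ (x ^ m))) (+-identityʳ (geo x m)))
geo-+ x m (suc n) rewrite ℕₚ.+-suc m n =
  ≈-trans (+-cong (geo-+ x m n) (^-homo-* x m n)) (Solver.join (geo x m) (x ^ m) (geo x n) (x ^ n))
  where
  module Solver where
    join : ∀ f x g y → f + x * g + x * y ≈ f + x * (g + y)
    join = solve-∀ polyRing

geo-* : ∀ x j d → geo x (d ℕ.* j) ≈ geo x j * geo (x ^ j) d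
geo-* x j zero    = ≈-sym (*-zeroʳ (geo x j))
geo-* x j (suc d) = begin
  geo x (j ℕ.+ d ℕ.* j)                          ≡⟨ cong (geo x) (ℕₚ.+-comm j (d ℕ.* j)) ⟩
  geo x (d ℕ.* j ℕ.+ j)                          ≈⟨ geo-+ x (d ℕ.* j) j ⟩
  geo x (d ℕ.* j) + x ^ (d ℕ.* j) * geo x j      ≈⟨ +-cong (geo-* x j d) (*-congʳ (geo x j) x^dj≈) ⟩
  geo x j * geo (x ^ j) d + (x ^ j) ^ d * geo x j ≈⟨ Solver.join (geo x j) (geo (x ^ j) d) ((x ^ j) ^ d) ⟩
  geo x j * (geo (x ^ j) d + (x ^ j) ^ d)        ∎
  where
  open SetoidReasoning ≈-setoid
  module Solver where
    join : ∀ f g y → f * g + y * f ≈ f * (g + y)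
    join = solve-∀ polyRing
  x^dj≈ : x ^ (d ℕ.* j) ≈ (x ^ j) ^ d
  x^dj≈ = ≈-trans (CommutativeRing.reflexive ℤ[q] (cong (x ^_) (ℕₚ.*-comm d j))) (≈-sym (^-assocʳ x j d))

1^n≈1 : ∀ n → 1# ^ n ≈ 1#
1^n≈1 zero    = ≈-refl
1^n≈1 (suc n) = ≈-trans (*-identityˡ (1# ^ n)) (1^n≈1 n)

geo-1 : ∀ n → geo 1# n ≈ const (+ n)
geo-1 zero    = ≈-sym 0∷[]≈[]
geo-1 (suc n) = ≈-trans (+-cong (geo-1 n) (1^n≈1 n))
  (CommutativeRing.reflexive ℤ[q] (cong (λ i → const (+ i)) (ℕₚ.+-comm n 1)))

geo-≋ : ∀ {m x y} → Congruence._≋_ m x y → ∀ n → Congruence._≋_ m (geo x n) (geo y n)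
geo-≋ {m} e zero    = Congruence.≋-refl m
geo-≋ {m} e (suc n) = Congruence.≋-+ m (geo-≋ e n) (Congruence.≋-^ m n e)

geo-≋-const : ∀ {m x} → Congruence._≋_ m x 1# → ∀ n → Congruence._≋_ m (geo x n) (const (+ n))
geo-≋-const {m} e n = Congruence.≋-trans m (geo-≋ e n) (Congruence.≈⇒≋ m (geo-1 n))

-- Finite sums and binomial coefficients

∑ : (ℕ → Poly) → ℕ → Poly
∑ f zero    = 0#
∑ f (suc n) = f 0 + ∑ (λ j → f (suc j)) n

∑-cong : ∀ {f g} n → (∀ j → f j ≈ g j) → ∑ f n ≈ ∑ g n
∑-cong zero    e = ≈-refl
∑-cong (suc n) e = +-cong (e 0) (∑-cong n (λ j → e (suc j)))

∑-≋ : ∀ {m f g} n → (∀ j → j < n → Congruence._≋_ m (f j) (g j)) → Congruence._≋_ m (∑ f n) (∑ g n)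
∑-≋ {m} zero    e = Congruence.≋-refl m
∑-≋ {m} (suc n) e = Congruence.≋-+ m (e 0 (s≤s z≤n)) (∑-≋ n (λ j j<n → e (suc j) (s≤s j<n)))

∑-0 : ∀ {f} n → (∀ j → f j ≈ 0#) → ∑ f n ≈ 0#
∑-0 zero    e = ≈-refl
∑-0 (suc n) e = +-cong (e 0) (∑-0 n (λ j → e (suc j)))

∑-+ : ∀ f g n → ∑ (λ j → f j + g j) n ≈ ∑ f n + ∑ g n
∑-+ f g zero    = ≈-refl
∑-+ f g (suc n) = ≈-trans (+-cong (≈-refl {f 0 + g 0}) (∑-+ (λ j → f (suc j)) (λ j → g (suc j)) n))
  (+-interchange (f 0) (g 0) _ _)

∑-*ˡ : ∀ a f n → ∑ (λ j → a * f j) n ≈ a * ∑ f n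
∑-*ˡ a f zero    = ≈-sym (*-zeroʳ a)
∑-*ˡ a f (suc n) = ≈-trans (+-cong (≈-refl {a * f 0}) (∑-*ˡ a (λ j → f (suc j)) n))
  (≈-sym (*-distribˡ-+ a (f 0) _))

∑-last : ∀ f n → ∑ f (suc n) ≈ ∑ f n + f n
∑-last f zero    = +-comm (f 0) 0#
∑-last f (suc n) = ≈-trans (+-cong (≈-refl {f 0}) (∑-last (λ j → f (suc j)) n))
  (≈-sym (+-assoc (f 0) _ _))

-- Unlike _C_, this computes by Pascal's rule.

binom : ℕ → ℕ → ℤ
binom n       zero    = 1ℤ
binom zero    (suc k) = 0ℤ
binom (suc n) (suc k) = binom n k ℤ.+ binom n (suc k)

-- The hockey-stick identity; the sum stops at j = n - 1, which accounts for the upper index n.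
∑-binom : ∀ k n → ∑ (λ j → const (binom j k)) n ≈ const (binom n (suc k))
∑-binom k zero    = ≈-sym 0∷[]≈[]
∑-binom k (suc n) = ≈-trans (∑-last (λ j → const (binom j k)) n)
  (≈-trans (+-cong (∑-binom k n) ≈-refl)
    (∷-cong (ℤₚ.+-comm (binom n (suc k)) (binom n k)) ≈-refl))

-- Coefficients of (x - q)(x - q²)⋯(x - qⁿ) around x = 0 and x = 1

-- The coefficient of x^j in (x - q)(x - q²)⋯(x - qⁿ).

x-coeff : ℕ → ℕ → Poly
x-coeff zero    zero    = 1#
x-coeff zero    (suc j) = 0#
x-coeff (suc n) zero    = - (q ^ suc n * x-coeff n 0)
x-coeff (suc n) (suc j) = x-coeff n j + - (q ^ suc n * x-coeff n (suc j))

-- Compare coefficients in (x - qⁿ) G(qx) = qⁿ (x - 1) G(x) for G(x) = (x - q)⋯(x - qⁿ).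

x-coeff-ratio : ∀ n j → (q * q ^ n * q ^ j + - (q ^ n)) * x-coeff n (suc j) ≈
    (q ^ j + - (q ^ n)) * x-coeff n j
x-coeff-ratio zero zero          = ≈-trans (*-zeroʳ (q * 1# * 1# + - 1#))
    (≈-sym (*-≈0ˡ {1# + - 1#} 1# 0∷[]≈[]))
x-coeff-ratio zero (suc j)       = ≈-trans (*-zeroʳ (q * 1# * q ^ suc j + - 1#))
    (≈-sym (*-zeroʳ (q ^ suc j + - 1#)))
x-coeff-ratio (suc n) zero       = begin
  (q * (q * x) * 1# + - (q * x)) * (x-coeff n 0 + - (q * x * x-coeff n 1))
    ≈⟨ Solver.expand q x (x-coeff n 0) (x-coeff n 1) ⟩
  (q * (q * x) + - (q * x)) * x-coeff n 0 + - (q * q * x * ((q * x * 1# + - x) * x-coeff n 1))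
    ≈⟨ +-cong ≈-refl (-‿cong (*-congˡ (q * q * x) (x-coeff-ratio n 0))) ⟩
  (q * (q * x) + - (q * x)) * x-coeff n 0 + - (q * q * x * ((1# + - x) * x-coeff n 0))
    ≈⟨ Solver.collect q x (x-coeff n 0) ⟩
  (1# + - (q * x)) * - (q * x * x-coeff n 0) ∎
  where
  open SetoidReasoning ≈-setoid
  x = q ^ n
  module Solver where
    expand : ∀ q x c₀ c₁ → (q * (q * x) * 1# + - (q * x)) * (c₀ + - (q * x * c₁)) ≈
      (q * (q * x) + - (q * x)) * c₀ + - (q * q * x * ((q * x * 1# + - x) * c₁))
    expand = solve-∀ polyRing
    collect : ∀ q x c₀ → (q * (q * x) + - (q * x)) * c₀ + - (q * q * x * ((1# + - x) * c₀)) ≈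
      (1# + - (q * x)) * - (q * x * c₀)
    collect = solve-∀ polyRing
x-coeff-ratio (suc n) (suc j)    = begin
  (q * (q * x) * (q * y) + - (q * x)) * (c₁ + - (q * x * c₂))
    ≈⟨ Solver.expand q x y c₁ c₂ ⟩
  (q * (q * x) * (q * y) + - (q * x)) * c₁ + - (q * q * x * ((q * x * (q * y) + - x) * c₂))
    ≈⟨ +-cong ≈-refl (-‿cong (*-congˡ (q * q * x) (x-coeff-ratio n (suc j)))) ⟩
  (q * (q * x) * (q * y) + - (q * x)) * c₁ + - (q * q * x * ((q * y + - x) * c₁))
    ≈⟨ Solver.regroup q x y c₁ ⟩
  q * ((q * x * y + - x) * c₁) + - ((q * y + - (q * x)) * (q * x * c₁))
    ≈⟨ +-cong (*-congˡ q (x-coeff-ratio n j)) ≈-refl ⟩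
  q * ((y + - x) * x-coeff n j) + - ((q * y + - (q * x)) * (q * x * c₁))
    ≈⟨ Solver.collect q x y (x-coeff n j) c₁ ⟩
  (q * y + - (q * x)) * (x-coeff n j + - (q * x * c₁)) ∎
  where
  open SetoidReasoning ≈-setoid
  x = q ^ n
  y = q ^ j
  c₁ = x-coeff n (suc j)
  c₂ = x-coeff n (suc (suc j))
  module Solver where
    expand : ∀ q x y c₁ c₂ → (q * (q * x) * (q * y) + - (q * x)) * (c₁ + - (q * x * c₂)) ≈
      (q * (q * x) * (q * y) + - (q * x)) * c₁ + - (q * q * x * ((q * x * (q * y) + - x) * c₂))
    expand = solve-∀ polyRing
    regroup : ∀ q x y c₁ →
      (q * (q * x) * (q * y) + - (q * x)) * c₁ + - (q * q * x * ((q * y + - x) * c₁)) ≈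
      q * ((q * x * y + - x) * c₁) + - ((q * y + - (q * x)) * (q * x * c₁))
    regroup = solve-∀ polyRing
    collect : ∀ q x y c₀ c₁ → q * ((y + - x) * c₀) + - ((q * y + - (q * x)) * (q * x * c₁)) ≈
      (q * y + - (q * x)) * (c₀ + - (q * x * c₁))
    collect = solve-∀ polyRing

x-coeff-zero : ∀ n j → n < j → x-coeff n j ≈ 0#
x-coeff-zero zero    (suc j) _         = ≈-refl
x-coeff-zero (suc n) (suc j) (s≤s n<j) = +-cong (x-coeff-zero n j n<j)
  (-‿cong (≈-trans (*-congˡ (q ^ suc n) (x-coeff-zero n (suc j) (ℕₚ.m<n⇒m<1+n n<j))) (*-zeroʳ (q ^ suc n))))

x-coeff-top : ∀ n → x-coeff n n ≈ 1#
x-coeff-top zero    = ≈-refl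
x-coeff-top (suc n) = +-cong (x-coeff-top n)
  (-‿cong (≈-trans (*-congˡ (q ^ suc n) (x-coeff-zero n (suc n) ℕₚ.≤-refl)) (*-zeroʳ (q ^ suc n))))

-- The coefficient of v^k in (1 - q + v)(1 - q² + v)⋯(1 - qⁿ + v).

v-coeff : ℕ → ℕ → Poly
v-coeff zero    zero    = 1#
v-coeff zero    (suc k) = 0#
v-coeff (suc n) zero    = (1# + - (q ^ suc n)) * v-coeff n 0
v-coeff (suc n) (suc k) = v-coeff n k + (1# + - (q ^ suc n)) * v-coeff n (suc k)

-- Substitute x = 1 + v and expand x^j by the binomial theorem. The N surplus terms vanish; they are
-- there because the induction step uses the hypothesis for n with sums of two different lengths.
taylor : ∀ n N k → v-coeff n k ≈ ∑ (λ j → const (binom j k) * x-coeff n j) (suc n ℕ.+ N)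
taylor zero    N k       = ≈-sym (begin
  const (binom 0 k) * 1# + ∑ (λ j → const (binom (suc j) k) * 0#) N
    ≈⟨ +-cong (*-comm (const (binom 0 k)) 1#) (∑-0 N (λ j → *-zeroʳ (const (binom (suc j) k)))) ⟩
  1# * const (binom 0 k) + 0#   ≈⟨ +-identityʳ _ ⟩
  1# * const (binom 0 k)        ≈⟨ *-identityˡ _ ⟩
  const (binom 0 k)             ≈⟨ base k ⟩
  v-coeff 0 k                         ∎)
  where
  open SetoidReasoning ≈-setoid
  base : ∀ k → const (binom 0 k) ≈ v-coeff 0 k
  base zero    = ≈-refl
  base (suc k) = 0∷[]≈[]
taylor (suc n) N k = ≈-sym (begin
  const (binom 0 k) * - (a * x-coeff n 0) + ∑
      (λ j → B (suc j) * (x-coeff n j + - (a * x-coeff n (suc j)))) M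
    ≈⟨ +-cong (≈-refl {const (binom 0 k) * - (a * x-coeff n 0)})
        (≈-trans (∑-cong M (λ j → Solver.split (B (suc j)) (x-coeff n j) a (x-coeff n (suc j))))
            (∑-+ (λ j → B (suc j) * x-coeff n j) (λ j → - a * (B (suc j) * x-coeff n (suc j))) M)) ⟩
  const (binom 0 k) * - (a * x-coeff n 0)
      + (∑ (λ j → B (suc j) * x-coeff n j) M + ∑ (λ j → - a * (B (suc j) * x-coeff n (suc j))) M)
    ≈⟨ +-cong (≈-refl {const (binom 0 k) * - (a * x-coeff n 0)})
        (+-cong (shifted k) (∑-*ˡ (- a) (λ j → B (suc j) * x-coeff n (suc j)) M)) ⟩
  const (binom 0 k) * - (a * x-coeff n 0) + (S k + - a * ∑ (λ j → B (suc j) * x-coeff n (suc j)) M)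
    ≈⟨ Solver.regroup (const (binom 0 k)) a (x-coeff n 0) (S k)
        (∑ (λ j → B (suc j) * x-coeff n (suc j)) M) ⟩
  S k + - (a * ∑ (λ j → B j * x-coeff n j) (suc M))
    ≡⟨ cong (λ i → S k + - (a * ∑ (λ j → B j * x-coeff n j) (suc i))) (sym (ℕₚ.+-suc n N)) ⟩
  S k + - (a * ∑ (λ j → B j * x-coeff n j) (suc n ℕ.+ suc N))
    ≈⟨ +-cong (≈-refl {S k}) (-‿cong (*-congˡ a (taylor n (suc N) k))) ⟨
  S k + - (a * v-coeff n k)
    ≈⟨ step k ⟩
  v-coeff (suc n) k ∎)
  where
  open SetoidReasoning ≈-setoid
  a = q ^ suc n
  M = suc n ℕ.+ N
  B = λ j → const (binom j k)
  -- `S k` is the coefficient of v^k in (1 + v) times the product for n, which is the contribution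
  -- of x in the new factor x - q^(n+1).
  S : ℕ → Poly
  S zero    = v-coeff n 0
  S (suc k) = v-coeff n k + v-coeff n (suc k)
  module Solver where
    split : ∀ b x a y → b * (x + - (a * y)) ≈ b * x + - a * (b * y)
    split = solve-∀ polyRing
    regroup : ∀ b a x s t → b * - (a * x) + (s + - a * t) ≈ s + - (a * (b * x + t))
    regroup = solve-∀ polyRing
    factor : ∀ x a → x + - (a * x) ≈ (1# + - a) * x
    factor = solve-∀ polyRing
    factor′ : ∀ y x a → y + x + - (a * x) ≈ y + (1# + - a) * x
    factor′ = solve-∀ polyRing
  shifted : ∀ k → ∑ (λ j → const (binom (suc j) k) * x-coeff n j) M ≈ S k
  shifted zero    = ≈-sym (taylor n N 0)
  shifted (suc k) = ≈-trans (∑-cong M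
      (λ j → *-distribʳ-+ (x-coeff n j) (const (binom j k)) (const (binom j (suc k)))))
    (≈-trans (∑-+ (λ j → const (binom j k) * x-coeff n j) (λ j → const (binom j (suc k)) * x-coeff n j)
        M) (+-cong (≈-sym (taylor n N k)) (≈-sym (taylor n N (suc k)))))
  step : ∀ k → S k + - (a * v-coeff n k) ≈ v-coeff (suc n) k
  step zero    = Solver.factor (v-coeff n 0) a
  step (suc k) = Solver.factor′ (v-coeff n k) (v-coeff n (suc k)) a

-- Reduction modulo [p] for a prime p = n + 1

module PrimeModulus (n : ℕ) (prime : Prime (suc n)) where

  p : ℕ
  p = suc n

  φ : Poly
  φ = geo q p

  open Congruence φ public

  φ₀≡1 : coeff φ 0 ≡ 1ℤ
  φ₀≡1 = trans (cong (λ f → coeff f 0) (sym ([]q≡geo p))) (coeff₀-[]q n)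

  q^p≋1 : q ^ p ≋ 1#
  q^p≋1 = mk≋ (q + - 1#) (geo-telescope q p)

  geo-multiple : ∀ l → geo q (l ℕ.* p) ≋ 0#
  geo-multiple l = ∣⇒≋0 (geo (q ^ p) l , ≈-trans (*-comm (geo (q ^ p) l) φ) (≈-sym (geo-* q p l)))

  -- A Bézout relation y j = 1 + x p gives [j] [y]_{q^j} = [1 + x p] ≡ 1, so [j] is a unit modulo
  -- [p]. With the opposite sign, 0 ≡ [x p] = 1 + q [j] [y]_{q^j} exhibits the inverse as well.
  regular-geo : ∀ j → Coprime p j → Regular φ (geo q j)
  regular-geo j coprime with coprime-Bézout coprime
  ... | Bézout.-+ x y eq = regular-unit (geo q j) (geo (q ^ j) y) (begin
    geo q j * geo (q ^ j) y       ≈⟨ ≈⇒≋ (geo-* q j y) ⟨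
    geo q (y ℕ.* j)               ≡⟨ cong (geo q) eq ⟨
    geo q (1 ℕ.+ x ℕ.* p)         ≈⟨ ≈⇒≋ (geo-+ q 1 (x ℕ.* p)) ⟩
    1# + q ^ 1 * geo q (x ℕ.* p)  ≈⟨ ≋-+ˡ 1# (≋-*ˡ (q ^ 1) (geo-multiple x)) ⟩
    1# + q ^ 1 * 0#               ≈⟨ ≈⇒≋ (+-cong (≈-refl {1#}) (*-zeroʳ (q ^ 1))) ⟩
    1#                            ∎)
    where open SetoidReasoning ≋-setoid
  ... | Bézout.+- x y eq = regular-unit (geo q j) (- (q ^ 1 * geo (q ^ j) y)) (begin
    geo q j * - (q ^ 1 * geo (q ^ j) y)
      ≈⟨ ≈⇒≋ (Solver.unit (geo q j) (q ^ 1) (geo (q ^ j) y)) ⟩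
    1# + - (1# + q ^ 1 * (geo q j * geo (q ^ j) y))
      ≈⟨ ≈⇒≋ (+-cong (≈-refl {1#}) (-‿cong (+-cong (≈-refl {1#}) (*-congˡ (q ^ 1) (geo-* q j y))))) ⟨
    1# + - (1# + q ^ 1 * geo q (y ℕ.* j))
      ≈⟨ ≈⇒≋ (+-cong (≈-refl {1#}) (-‿cong (geo-+ q 1 (y ℕ.* j)))) ⟨
    1# + - geo q (1 ℕ.+ y ℕ.* j)
      ≡⟨ cong (λ i → 1# + - geo q i) eq ⟩
    1# + - geo q (x ℕ.* p)
      ≈⟨ ≋-+ˡ 1# (≋-neg (geo-multiple x)) ⟩
    1# ∎)
    where
    open SetoidReasoning ≋-setoid
    module Solver where
      unit : ∀ a b c → a * - (b * c) ≈ 1# + - (1# + b * (a * c))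
      unit = solve-∀ polyRing

  -- Modulo q - 1, φ is the nonzero integer p.
  regular-q-1 : Regular φ (q + - 1#)
  regular-q-1 = regular-factorʳ (- r) (q + - 1#) (regular-resp p≋ (regular-const φ₀≡1 (+ p)))
    where
    open SetoidReasoning ≋-setoid
    y = q + - 1#
    module Solver where
      unit : ∀ x → x ≈ 1# + 1# * (x + - 1#)
      unit = solve-∀ polyRing
      move : ∀ x r y → x ≈ x + r * y + - r * y
      move = solve-∀ polyRing
    φ≋p : Congruence._≋_ y φ (const (+ p))
    φ≋p = geo-≋-const {y} {q} (Congruence.mk≋ 1# (Solver.unit q)) p
    r = Congruence._≋_.quotient φ≋p
    p≋ : const (+ p) ≋ - r * y
    p≋ = begin
      const (+ p)                    ≈⟨ ≈⇒≋ (Solver.move (const (+ p)) r y) ⟩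
      const (+ p) + r * y + - r * y  ≈⟨ ≈⇒≋ (+-cong (Congruence._≋_.equality φ≋p) (≈-refl { - r * y})) ⟨
      φ + - r * y                    ≈⟨ ≋-+ʳ (- r * y) (∣⇒≋0 (1# , *-identityˡ φ)) ⟩
      - r * y                        ∎

  regular-q^ : ∀ j → j ≤ p → Regular φ (q ^ j)
  regular-q^ j j≤p = regular-unit (q ^ j) (q ^ (p ℕ.∸ j)) (begin
    q ^ j * q ^ (p ℕ.∸ j)   ≈⟨ ≈⇒≋ (^-homo-* q j (p ℕ.∸ j)) ⟨
    q ^ (j ℕ.+ (p ℕ.∸ j))   ≡⟨ cong (q ^_) (ℕₚ.m+[n∸m]≡n j≤p) ⟩
    q ^ p                   ≈⟨ q^p≋1 ⟩
    1#                      ∎)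
    where open SetoidReasoning ≋-setoid

  -- The difference is -q^j (q - 1) [d+1], and 0 < d + 1 < p makes [d+1] a unit.
  regular-difference : ∀ j d → j ℕ.+ suc d < p → Regular φ (q ^ j + - (q ^ (j ℕ.+ suc d)))
  regular-difference j d j+d<p = regular-resp (≈⇒≋ (≈-sym (begin
    q ^ j + - (q ^ (j ℕ.+ suc d))      ≈⟨ +-cong (≈-refl {q ^ j}) (-‿cong (^-homo-* q j (suc d))) ⟩
    q ^ j + - (q ^ j * q ^ suc d)
        ≈⟨ +-cong (≈-refl {q ^ j}) (-‿cong (*-congˡ (q ^ j) (geo-telescope q (suc d)))) ⟩
    q ^ j + - (q ^ j * (1# + (q + - 1#) * geo q (suc d)))
        ≈⟨ Solver.factor (q ^ j) (q + - 1#) (geo q (suc d)) ⟩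
    (- 1# * q ^ j) * ((q + - 1#) * geo q (suc d)) ∎)))
    (regular-*
      (regular-* (regular-unit (- 1#) (- 1#) (≈⇒≋ ≈-refl))
          (regular-q^ j (ℕₚ.≤-trans (ℕₚ.m≤m+n j (suc d)) (ℕₚ.<⇒≤ j+d<p))))
      (regular-* regular-q-1
        (regular-geo (suc d) (prime⇒coprime prime (ℕₚ.≤-trans (s≤s (ℕₚ.m≤n+m (suc d) j)) j+d<p)))))
    where
    open SetoidReasoning ≈-setoid
    module Solver where
      factor : ∀ x y g → x + - (x * (1# + y * g)) ≈ (- 1# * x) * (y * g)
      factor = solve-∀ polyRing

  -- Modulo [p] the factor q^(n+1+j) - q^n in `x-coeff-ratio` becomes q^j - q^n, because n + 1 = p.
  -- Both sides then carry the same regular factor, so neighbouring coefficients agree; the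
  -- induction on d = n - j descends from the leading coefficient 1.
  x-coeff≋1 : ∀ d j → j ℕ.+ d ≡ n → x-coeff n j ≋ 1#
  x-coeff≋1 zero    j j+d≡n rewrite trans (sym (ℕₚ.+-identityʳ j)) j+d≡n = ≈⇒≋ (x-coeff-top n)
  x-coeff≋1 (suc d) j refl = regular-cancel
    (regular-difference j d ℕₚ.≤-refl) (x-coeff n j) 1# (begin
      (q ^ j + - (q ^ n)) * x-coeff n j                      ≈⟨ ≈⇒≋ (x-coeff-ratio n j) ⟨
      (q * q ^ n * q ^ j + - (q ^ n)) * x-coeff n (suc j)
          ≈⟨ ≋-* (≋-+ʳ (- (q ^ n)) (≋-*ʳ (q ^ j) q^p≋1)) (x-coeff≋1 d (suc j) (sym (ℕₚ.+-suc j d))) ⟩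
      (1# * q ^ j + - (q ^ n)) * 1#
          ≈⟨ ≈⇒≋ (*-congʳ 1# (+-cong (*-identityˡ (q ^ j)) (≈-refl { - (q ^ n)}))) ⟩
      (q ^ j + - (q ^ n)) * 1#                         ∎)
    where open SetoidReasoning ≋-setoid

  v-coeff≋binom : ∀ k → v-coeff n k ≋ const (binom p (suc k))
  v-coeff≋binom k = begin
    v-coeff n k
      ≈⟨ ≈⇒≋ (taylor n 0 k) ⟩
    ∑ (λ j → const (binom j k) * x-coeff n j) (suc n ℕ.+ 0)
      ≡⟨ cong (∑ (λ j → const (binom j k) * x-coeff n j)) (ℕₚ.+-identityʳ p) ⟩
    ∑ (λ j → const (binom j k) * x-coeff n j) p
      ≈⟨ ∑-≋ {f = λ j → const (binom j k) * x-coeff n j} {g = λ j → const (binom j k)} p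
          (λ { j (s≤s j≤n) → ≋-trans (≋-*ˡ (const (binom j k)) (x-coeff≋1 (n ℕ.∸ j) j (ℕₚ.m+[n∸m]≡n j≤n)))
           (≈⇒≋ (≈-trans (*-comm (const (binom j k)) 1#) (*-identityˡ _))) }) ⟩
    ∑ (λ j → const (binom j k)) p
      ≈⟨ ≈⇒≋ (∑-binom k p) ⟩
    const (binom p (suc k)) ∎
    where open SetoidReasoning ≋-setoid

-- Products and their division into blocks of length p

-- The index runs from 1 to n, whereas that of ∑ runs from 0 to n - 1.

prod : (ℕ → Poly) → ℕ → Poly
prod f zero    = 1#
prod f (suc n) = f (suc n) * prod f n

prod-cong : ∀ {f g} n → (∀ i → f i ≈ g i) → prod f n ≈ prod g n
prod-cong zero    f≈g = ≈-refl
prod-cong (suc n) f≈g = *-cong (f≈g (suc n)) (prod-cong n f≈g)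

prod-first : ∀ f n → prod f (suc n) ≈ prod (λ i → f (suc i)) n * f 1
prod-first f zero    = *-comm (f 1) 1#
prod-first f (suc n) = ≈-trans (*-congˡ (f (suc (suc n))) (prod-first f n))
  (≈-sym (*-assoc (f (suc (suc n))) (prod (λ i → f (suc i)) n) (f 1)))

prod-+ : ∀ f j N → prod f (j ℕ.+ N) ≈ prod (λ i → f (i ℕ.+ N)) j * prod f N
prod-+ f zero    N = ≈-sym (*-identityˡ (prod f N))
prod-+ f (suc j) N = ≈-trans (*-congˡ (f (suc j ℕ.+ N)) (prod-+ f j N))
  (≈-sym (*-assoc (f (suc j ℕ.+ N)) (prod (λ i → f (i ℕ.+ N)) j) (prod f N)))

-- Here v is a given polynomial. It will be a multiple of t, so the remainder r v³ disappears modulo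
-- [p]³ whatever r is.
prod-expansion : ∀ n v → ∃ λ r → prod (λ i → 1# + - (q ^ i) + v) n ≈
    v-coeff n 0 + v-coeff n 1 * v + v-coeff n 2 * (v * v) + r * (v * v * v)
prod-expansion zero    v = const 0ℤ ×., Solver.base v
  where
  module Solver where
    base : ∀ v → 1# ≈ 1# + 0# * v + 0# * (v * v) + const 0ℤ * (v * v * v)
    base = solve-∀ polyRing
prod-expansion (suc n) v with prod-expansion n v
... | r ×., eq = v-coeff n 2 + (1# + - x + v) * r ×., ≈-trans (*-congˡ (1# + - x + v) eq)
  (Solver.step x v (v-coeff n 0) (v-coeff n 1) (v-coeff n 2) r)
  where
  x = q ^ suc n
  module Solver where
    step : ∀ x v e₀ e₁ e₂ r →
      (1# + - x + v) * (e₀ + e₁ * v + e₂ * (v * v) + r * (v * v * v)) ≈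
      (1# + - x) * e₀ + (e₀ + (1# + - x) * e₁) * v + (e₁ + (1# + - x) * e₂) * (v * v)
        + (e₂ + (1# + - x + v) * r) * (v * v * v)
    step = solve-∀ polyRing

v-coeff₀≈prod : ∀ n → v-coeff n 0 ≈ prod (λ i → 1# + - (q ^ i)) n
v-coeff₀≈prod zero    = ≈-refl
v-coeff₀≈prod (suc n) = *-congˡ (1# + - (q ^ suc n)) (v-coeff₀≈prod n)

-- Take -q^i out of each factor and reverse the order by i ↦ j + 1 - i. The induction splits off the
-- top factor on the left, which is the bottom one on the right; raising N by one keeps the exponent
-- j + 1 + N fixed.
prod-reflect : ∀ j N → prod (λ i → q ^ (suc j ℕ.+ N) + - (q ^ i)) j ≈
  prod (λ i → - (q ^ i)) j * prod (λ i → 1# + - (q ^ (i ℕ.+ N))) j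
prod-reflect zero    N = ≈-refl
prod-reflect (suc j) N = begin
  (q ^ (suc (suc j) ℕ.+ N) + - x) * prod (λ i → q ^ (suc (suc j) ℕ.+ N) + - (q ^ i)) j
    ≈⟨ *-cong (+-cong (≈-trans (reflexive (cong (q ^_) (sym (ℕₚ.+-suc (suc j) N))))
        (^-homo-* q (suc j) (suc N))) (≈-refl { - x}))
         (≈-trans (reflexive (cong (λ k → prod (λ i → q ^ k + - (q ^ i)) j) (sym (ℕₚ.+-suc (suc j) N))))
             (prod-reflect j (suc N))) ⟩
  (x * y + - x) * (A * prod (λ i → 1# + - (q ^ (i ℕ.+ suc N))) j)
    ≈⟨ *-congˡ (x * y + - x) (*-congˡ A
        (prod-cong j (λ i → reflexive (cong (λ k → 1# + - (q ^ k)) (ℕₚ.+-suc i N))))) ⟩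
  (x * y + - x) * (A * B)
    ≈⟨ Solver.regroup x y A B ⟩
  (- x * A) * (B * (1# + - y))
    ≈⟨ *-congˡ (- x * A) (prod-first (λ i → 1# + - (q ^ (i ℕ.+ N))) j) ⟨
  (- x * A) * prod (λ i → 1# + - (q ^ (i ℕ.+ N))) (suc j) ∎
  where
  open SetoidReasoning ≈-setoid
  open CommutativeRing ℤ[q] using (reflexive)
  x = q ^ suc j
  y = q ^ suc N
  A = prod (λ i → - (q ^ i)) j
  B = prod (λ i → 1# + - (q ^ (suc i ℕ.+ N))) j
  module Solver where
    regroup : ∀ x y A B → (x * y + - x) * (A * B) ≈ (- x * A) * (B * (1# + - y))
    regroup = solve-∀ polyRing

-- The number of factors is even, so the signs cancel, and 1 + ⋯ + 2m = m (2m + 1) = m p. This is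
-- the origin of the factor Q^m.
prod-neg : ∀ m → prod (λ i → - (q ^ i)) (m ℕ.+ m) ≈ q ^ (m ℕ.* suc (m ℕ.+ m))
prod-neg zero    = ≈-refl
prod-neg (suc m) rewrite ℕₚ.+-suc m m = begin
  - (q * (q * x)) * (- (q * x) * prod (λ i → - (q ^ i)) (m ℕ.+ m))
    ≈⟨ *-congˡ (- (q * (q * x))) (*-congˡ (- (q * x)) (prod-neg m)) ⟩
  - (q * (q * x)) * (- (q * x) * q ^ (m ℕ.* suc (m ℕ.+ m)))
    ≈⟨ Solver.collect q x (q ^ (m ℕ.* suc (m ℕ.+ m))) ⟩
  q * (q * (q * (x * (x * q ^ (m ℕ.* suc (m ℕ.+ m))))))
    ≈⟨ *-congˡ q (*-congˡ q (*-congˡ q (*-congˡ x (^-homo-* q (m ℕ.+ m) (m ℕ.* suc (m ℕ.+ m)))))) ⟨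
  q * (q * (q * (x * q ^ (m ℕ.+ m ℕ.+ m ℕ.* suc (m ℕ.+ m)))))
    ≈⟨ *-congˡ q (*-congˡ q (*-congˡ q (^-homo-* q (m ℕ.+ m) (m ℕ.+ m ℕ.+ m ℕ.* suc (m ℕ.+ m))))) ⟨
  q ^ suc (suc (suc (m ℕ.+ m ℕ.+ (m ℕ.+ m ℕ.+ m ℕ.* suc (m ℕ.+ m)))))
    ≡⟨ cong (q ^_) (exponents m) ⟩
  q ^ (suc m ℕ.* suc (suc (suc (m ℕ.+ m)))) ∎
  where
  open SetoidReasoning ≈-setoid
  x = q ^ (m ℕ.+ m)
  exponents : ∀ m → suc (suc (suc (m ℕ.+ m ℕ.+ (m ℕ.+ m ℕ.+ m ℕ.* suc (m ℕ.+ m))))) ≡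
    suc m ℕ.* suc (suc (suc (m ℕ.+ m)))
  exponents = ℕSolver.solve-∀
  module Solver where
    collect : ∀ q x z → - (q * (q * x)) * (- (q * x) * z) ≈ q * (q * (q * (x * (x * z))))
    collect = solve-∀ polyRing

[]!q≈prod : ∀ n → (1# + - q) ^ n * [ n ]!q ≈ prod (λ i → 1# + - (q ^ i)) n
[]!q≈prod zero    = *-identityˡ 1#
[]!q≈prod (suc n) = begin
  (1# + - q) * (1# + - q) ^ n * ([ suc n ]q * [ n ]!q)
    ≈⟨ Solver.regroup q ((1# + - q) ^ n) [ suc n ]q [ n ]!q ⟩
  (1# + - (1# + (q + - 1#) * [ suc n ]q)) * ((1# + - q) ^ n * [ n ]!q)
    ≈⟨ *-cong (+-cong (≈-refl {1#}) (-‿cong (≈-sym q^≈))) ([]!q≈prod n) ⟩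
  (1# + - (q ^ suc n)) * prod (λ i → 1# + - (q ^ i)) n ∎
  where
  open SetoidReasoning ≈-setoid
  q^≈ : q ^ suc n ≈ 1# + (q + - 1#) * [ suc n ]q
  q^≈ = subst (λ g → q ^ suc n ≈ 1# + (q + - 1#) * g) (sym ([]q≡geo (suc n))) (geo-telescope q (suc n))
  module Solver where
    regroup : ∀ q x g y → (1# + - q) * x * (g * y) ≈ (1# + - (1# + (q + - 1#) * g)) * (x * y)
    regroup = solve-∀ polyRing

module _ (m : ℕ) where

  private
    n = m ℕ.+ m
    p = suc n
    Q = q ^ p

  K : ℕ → Poly
  K j = prod (λ i → q ^ (j ℕ.* p) + - (q ^ i)) n

  K-suc : ∀ l → K (suc l) ≈ Q ^ m * prod (λ i → 1# + - (q ^ (i ℕ.+ l ℕ.* p))) n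
  K-suc l = ≈-trans (prod-reflect n (l ℕ.* p)) (*-congʳ _ (≈-trans (prod-neg m)
    (≈-trans (CommutativeRing.reflexive ℤ[q] (cong (q ^_) (ℕₚ.*-comm m p))) (≈-sym (^-assocʳ q p m)))))

  q^[*p]≈ : ∀ j → q ^ (j ℕ.* p) ≈ 1# + (Q + - 1#) * geo Q j
  q^[*p]≈ j = ≈-trans (CommutativeRing.reflexive ℤ[q] (cong (q ^_) (ℕₚ.*-comm j p)))
    (≈-trans (≈-sym (^-assocʳ q p j)) (geo-telescope Q j))

  -- In the block l p < i ≤ (l+1) p the last factor is 1 - Q^(l+1) = (1 - Q) [l+1]_Q, and the other
  -- p - 1 factors times Q^m are `K (suc l)`.
  prod-blocks : ∀ l → (Q ^ m) ^ l * prod (λ i → 1# + - (q ^ i)) (l ℕ.* p) ≈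
    (1# + - Q) ^ l * prod (λ j → geo Q j * K j) l
  prod-blocks zero    = ≈-refl
  prod-blocks (suc l) = begin
    M * M ^ l * prod f (p ℕ.+ l ℕ.* p)
      ≈⟨ *-congˡ (M * M ^ l) (prod-+ f p (l ℕ.* p)) ⟩
    M * M ^ l * ((1# + - (q ^ (suc l ℕ.* p))) * B * D)
      ≈⟨ Solver.regroup M (M ^ l) (q ^ (suc l ℕ.* p)) B D ⟩
    (1# + - (q ^ (suc l ℕ.* p))) * (M * B) * (M ^ l * D)
      ≈⟨ *-cong (*-cong (+-cong (≈-refl {1#}) (-‿cong (q^[*p]≈ (suc l)))) (≈-sym (K-suc l)))
          (prod-blocks l) ⟩
    (1# + - (1# + (Q + - 1#) * G)) * K (suc l) * ((1# + - Q) ^ l * prod (λ j → geo Q j * K j) l)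
      ≈⟨ Solver.collect Q G (K (suc l)) ((1# + - Q) ^ l) (prod (λ j → geo Q j * K j) l) ⟩
    (1# + - Q) * (1# + - Q) ^ l * (G * K (suc l) * prod (λ j → geo Q j * K j) l) ∎
    where
    open SetoidReasoning ≈-setoid
    f = λ i → 1# + - (q ^ i)
    M = Q ^ m
    D = prod f (l ℕ.* p)
    B = prod (λ i → f (i ℕ.+ l ℕ.* p)) n
    G = geo Q (suc l)
    module Solver where
      regroup : ∀ M N x B D → M * N * ((1# + - x) * B * D) ≈ (1# + - x) * (M * B) * (N * D)
      regroup = solve-∀ polyRing
      collect : ∀ Q G K x y → (1# + - (1# + (Q + - 1#) * G)) * K * (x * y) ≈ (1# + - Q) * x * (G * K * y)
      collect = solve-∀ polyRing

-- Closed forms of small binomial coefficients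

binom-1 : ∀ n → binom n 1 ≡ + n
binom-1 zero    = refl
binom-1 (suc n) = cong (λ x → 1ℤ ℤ.+ x) (binom-1 n)

2*binom-2 : ∀ n → + 2 ℤ.* binom n 2 ≡ + n ℤ.* (+ n ℤ.- 1ℤ)
2*binom-2 zero    = refl
2*binom-2 (suc n) = begin
  + 2 ℤ.* (binom n 1 ℤ.+ binom n 2)               ≡⟨ cong (λ x → + 2 ℤ.* (x ℤ.+ binom n 2)) (binom-1 n) ⟩
  + 2 ℤ.* (+ n ℤ.+ binom n 2)                     ≡⟨ ℤₚ.*-distribˡ-+ (+ 2) (+ n) (binom n 2) ⟩
  + 2 ℤ.* + n ℤ.+ + 2 ℤ.* binom n 2               ≡⟨ cong (λ x → + 2 ℤ.* + n ℤ.+ x) (2*binom-2 n) ⟩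
  + 2 ℤ.* + n ℤ.+ + n ℤ.* (+ n ℤ.- 1ℤ)            ≡⟨ Solver.collect (+ n) ⟩
  (1ℤ ℤ.+ + n) ℤ.* (1ℤ ℤ.+ + n ℤ.- 1ℤ)            ∎
  where
  open ≡-Reasoning
  module Solver where
    collect : ∀ n → + 2 ℤ.* n ℤ.+ n ℤ.* (n ℤ.- 1ℤ) ≡ (1ℤ ℤ.+ n) ℤ.* (1ℤ ℤ.+ n ℤ.- 1ℤ)
    collect = ℤSolver.solve-∀

6*binom-3 : ∀ n → + 6 ℤ.* binom n 3 ≡ + n ℤ.* (+ n ℤ.- 1ℤ) ℤ.* (+ n ℤ.- + 2)
6*binom-3 zero    = refl
6*binom-3 (suc n) = begin
  + 6 ℤ.* (binom n 2 ℤ.+ binom n 3)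
    ≡⟨ Solver.split (binom n 2) (binom n 3) ⟩
  + 3 ℤ.* (+ 2 ℤ.* binom n 2) ℤ.+ + 6 ℤ.* binom n 3
    ≡⟨ cong₂ (λ x y → + 3 ℤ.* x ℤ.+ y) (2*binom-2 n) (6*binom-3 n) ⟩
  + 3 ℤ.* (+ n ℤ.* (+ n ℤ.- 1ℤ)) ℤ.+ + n ℤ.* (+ n ℤ.- 1ℤ) ℤ.* (+ n ℤ.- + 2)
    ≡⟨ Solver.collect (+ n) ⟩
  (1ℤ ℤ.+ + n) ℤ.* (1ℤ ℤ.+ + n ℤ.- 1ℤ) ℤ.* (1ℤ ℤ.+ + n ℤ.- + 2) ∎
  where
  open ≡-Reasoning
  module Solver where
    split : ∀ x y → + 6 ℤ.* (x ℤ.+ y) ≡ + 3 ℤ.* (+ 2 ℤ.* x) ℤ.+ + 6 ℤ.* y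
    split = ℤSolver.solve-∀
    collect : ∀ n → + 3 ℤ.* (n ℤ.* (n ℤ.- 1ℤ)) ℤ.+ n ℤ.* (n ℤ.- 1ℤ) ℤ.* (n ℤ.- + 2) ≡
      (1ℤ ℤ.+ n) ℤ.* (1ℤ ℤ.+ n ℤ.- 1ℤ) ℤ.* (1ℤ ℤ.+ n ℤ.- + 2)
    collect = ℤSolver.solve-∀

-- Second-order Taylor polynomials in t

module Jets (Φ t : Poly) (t³≋0 : Congruence._≋_ Φ (t * t * t) 0#) where

  open Congruence Φ

  -- With integer coefficients, a congruence modulo `Φ` follows from three equations in ℤ, where
  -- denominators can be cleared and cancelled freely.
  record Jet (x : Poly) (a b c : ℤ) : Set where
    constructor mkJet
    field expansion : x ≋ const a + const b * t + const c * (t * t)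

  jet-resp : ∀ {x a b c a′ b′ c′} → a ≡ a′ → b ≡ b′ → c ≡ c′ → Jet x a b c → Jet x a′ b′ c′
  jet-resp refl refl refl j = j

  jet-≈ : ∀ {x y a b c} → x ≈ y → Jet y a b c → Jet x a b c
  jet-≈ x≈y (mkJet j) = mkJet (≋-trans (≈⇒≋ x≈y) j)

  jet-unique : ∀ {x y a b c a′ b′ c′} → a ≡ a′ → b ≡ b′ → c ≡ c′ → Jet x a b c → Jet y a′ b′ c′ → x ≋ y
  jet-unique refl refl refl (mkJet j) (mkJet j′) = ≋-trans j (≋-sym j′)

  jet-const : ∀ a → Jet (const a) a 0ℤ 0ℤ
  jet-const a = mkJet (≈⇒≋ (Solver.expand (const a) t))
    where
    module Solver where
      expand : ∀ a t → a ≈ a + const 0ℤ * t + const 0ℤ * (t * t)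
      expand = solve-∀ polyRing

  jet-const*t² : ∀ c → Jet (const c * (t * t)) 0ℤ 0ℤ c
  jet-const*t² c = mkJet (≈⇒≋ (Solver.expand (const c) t))
    where
    module Solver where
      expand : ∀ c t → c * (t * t) ≈ const 0ℤ + const 0ℤ * t + c * (t * t)
      expand = solve-∀ polyRing

  jet-1+t : Jet (1# + t) 1ℤ 1ℤ 0ℤ
  jet-1+t = mkJet (≈⇒≋ (Solver.expand t))
    where
    module Solver where
      expand : ∀ t → 1# + t ≈ 1# + const 1ℤ * t + const 0ℤ * (t * t)
      expand = solve-∀ polyRing

  jet-+ : ∀ {x y a b c a′ b′ c′} → Jet x a b c → Jet y a′ b′ c′ →
      Jet (x + y) (a ℤ.+ a′) (b ℤ.+ b′) (c ℤ.+ c′)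
  jet-+ {a = a} {b} {c} {a′} {b′} {c′} (mkJet j) (mkJet j′) = mkJet (≋-trans (≋-+ j j′)
    (≈⇒≋ (Solver.collect t (const a) (const b) (const c) (const a′) (const b′) (const c′))))
    where
    module Solver where
      collect : ∀ t a b c a′ b′ c′ → (a + b * t + c * (t * t)) + (a′ + b′ * t + c′ * (t * t)) ≈
        (a + a′) + (b + b′) * t + (c + c′) * (t * t)
      collect = solve-∀ polyRing

  jet-neg : ∀ {x a b c} → Jet x a b c → Jet (- x) (ℤ.- a) (ℤ.- b) (ℤ.- c)
  jet-neg {a = a} {b} {c} (mkJet j) = mkJet
      (≋-trans (≋-neg j) (≈⇒≋ (Solver.collect t (const a) (const b) (const c))))
    where
    module Solver where
      collect : ∀ t a b c → - (a + b * t + c * (t * t)) ≈ - a + - b * t + - c * (t * t)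
      collect = solve-∀ polyRing

  jet-* : ∀ {x y a b c a′ b′ c′} → Jet x a b c → Jet y a′ b′ c′ →
    Jet (x * y) (a ℤ.* a′) (a ℤ.* b′ ℤ.+ b ℤ.* a′) (a ℤ.* c′ ℤ.+ b ℤ.* b′ ℤ.+ c ℤ.* a′)
  jet-* {x} {y} {a} {b} {c} {a′} {b′} {c′} (mkJet j) (mkJet j′) = mkJet (begin
    x * y
      ≈⟨ ≋-* j j′ ⟩
    (A₀ + A₁ * t + A₂ * (t * t)) * (B₀ + B₁ * t + B₂ * (t * t))
      ≈⟨ ≈⇒≋ (Solver.expand t A₀ A₁ A₂ B₀ B₁ B₂) ⟩
    A₀ * B₀ + (A₀ * B₁ + A₁ * B₀) * t + (A₀ * B₂ + A₁ * B₁ + A₂ * B₀) * (t * t)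
      + (A₁ * B₂ + A₂ * B₁ + A₂ * B₂ * t) * (t * t * t)
      ≈⟨ ≋-+ˡ _ (≋-*ˡ (A₁ * B₂ + A₂ * B₁ + A₂ * B₂ * t) t³≋0) ⟩
    A₀ * B₀ + (A₀ * B₁ + A₁ * B₀) * t + (A₀ * B₂ + A₁ * B₁ + A₂ * B₀) * (t * t)
      + (A₁ * B₂ + A₂ * B₁ + A₂ * B₂ * t) * 0#
      ≈⟨ ≈⇒≋ (Solver.drop (A₀ * B₀ + (A₀ * B₁ + A₁ * B₀) * t + (A₀ * B₂ + A₁ * B₁ + A₂ * B₀) * (t * t))
          (A₁ * B₂ + A₂ * B₁ + A₂ * B₂ * t)) ⟩
    A₀ * B₀ + (A₀ * B₁ + A₁ * B₀) * t + (A₀ * B₂ + A₁ * B₁ + A₂ * B₀) * (t * t)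
      ≈⟨ ≈⇒≋ (+-cong (+-cong (const-* a a′) (*-congʳ t (+-cong (const-* a b′) (const-* b a′))))
           (*-congʳ (t * t) (+-cong (+-cong (const-* a c′) (const-* b b′)) (const-* c a′)))) ⟨
    const (a ℤ.* a′) + const (a ℤ.* b′ ℤ.+ b ℤ.* a′) * t + const (a ℤ.* c′ ℤ.+ b ℤ.* b′ ℤ.+ c ℤ.* a′)
        * (t * t) ∎)
    where
    open SetoidReasoning ≋-setoid
    A₀ = const a
    A₁ = const b
    A₂ = const c
    B₀ = const a′
    B₁ = const b′
    B₂ = const c′
    module Solver where
      expand : ∀ t A₀ A₁ A₂ B₀ B₁ B₂ → (A₀ + A₁ * t + A₂ * (t * t)) * (B₀ + B₁ * t + B₂ * (t * t)) ≈
        A₀ * B₀ + (A₀ * B₁ + A₁ * B₀) * t + (A₀ * B₂ + A₁ * B₁ + A₂ * B₀) * (t * t)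
          + (A₁ * B₂ + A₂ * B₁ + A₂ * B₂ * t) * (t * t * t)
      expand = solve-∀ polyRing
      drop : ∀ x y → x + y * 0# ≈ x
      drop = solve-∀ polyRing

  jet-^ : ∀ {x b c} → Jet x 1ℤ b c → ∀ n →
    Jet (x ^ n) 1ℤ (b ℤ.* binom n 1) (c ℤ.* binom n 1 ℤ.+ b ℤ.* b ℤ.* binom n 2)
  jet-^ {b = b} {c} j zero    = jet-resp refl (sym (ℤₚ.*-zeroʳ b)) (sym (Solver.base b c)) (jet-const 1ℤ)
    where
    module Solver where
      base : ∀ b c → c ℤ.* 0ℤ ℤ.+ b ℤ.* b ℤ.* 0ℤ ≡ 0ℤ
      base = ℤSolver.solve-∀
  jet-^ {x} {b} {c} j (suc n) =
    jet-resp refl (Solver.linear b (binom n 1)) (Solver.quadratic b c (binom n 1) (binom n 2))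
        (jet-* j (jet-^ j n))
    where
    module Solver where
      linear : ∀ b k → 1ℤ ℤ.* (b ℤ.* k) ℤ.+ b ℤ.* 1ℤ ≡ b ℤ.* (1ℤ ℤ.+ k)
      linear = ℤSolver.solve-∀
      quadratic : ∀ b c k l → 1ℤ ℤ.* (c ℤ.* k ℤ.+ b ℤ.* b ℤ.* l) ℤ.+ b ℤ.* (b ℤ.* k) ℤ.+ c ℤ.* 1ℤ ≡
        c ℤ.* (1ℤ ℤ.+ k) ℤ.+ b ℤ.* b ℤ.* (k ℤ.+ l)
      quadratic = ℤSolver.solve-∀

  jet-geo : ∀ {x b c} → Jet x 1ℤ b c → ∀ n →
    Jet (geo x n) (binom n 1) (b ℤ.* binom n 2) (c ℤ.* binom n 2 ℤ.+ b ℤ.* b ℤ.* binom n 3)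
  jet-geo {b = b} {c} j zero    = jet-resp refl (sym (ℤₚ.*-zeroʳ b)) (sym (Solver.base b c))
    (jet-≈ (≈-sym 0∷[]≈[]) (jet-const 0ℤ))
    where
    module Solver where
      base : ∀ b c → c ℤ.* 0ℤ ℤ.+ b ℤ.* b ℤ.* 0ℤ ≡ 0ℤ
      base = ℤSolver.solve-∀
  jet-geo {x} {b} {c} j (suc n) =
    jet-resp (ℤₚ.+-comm (binom n 1) 1ℤ) (Solver.linear b (binom n 1) (binom n 2))
      (Solver.quadratic b c (binom n 1) (binom n 2) (binom n 3)) (jet-+ (jet-geo j n) (jet-^ j n))
    where
    module Solver where
      linear : ∀ b k l → b ℤ.* l ℤ.+ b ℤ.* k ≡ b ℤ.* (k ℤ.+ l)
      linear = ℤSolver.solve-∀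
      quadratic : ∀ b c k l h → (c ℤ.* l ℤ.+ b ℤ.* b ℤ.* h) ℤ.+ (c ℤ.* k ℤ.+ b ℤ.* b ℤ.* l) ≡
        c ℤ.* (k ℤ.+ l) ℤ.+ b ℤ.* b ℤ.* (l ℤ.+ h)
      quadratic = ℤSolver.solve-∀

-- The integer identities behind the comparison of Taylor polynomials

-- The two t² coefficients to be matched in `geo*θ≋`, with n the index of the block, `P` = p, `P₂` =
-- C(p,2), `y` = C(m,2), `x₂` = C(n,2) and `x₃` = C(n,3). Multiplication by 12 clears all
-- denominators and leaves a polynomial identity in m and n.
quadratic-coefficients : ∀ (m γ a P P₂ y n x₂ x₃ : ℤ) →
  + 3 ℤ.* γ ≡ m ℤ.* (+ 2 ℤ.* m ℤ.- 1ℤ) → + 6 ℤ.* a ≡ m ℤ.* (m ℤ.+ 1ℤ) →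
  P ≡ 1ℤ ℤ.+ + 2 ℤ.* m → + 2 ℤ.* P₂ ≡ P ℤ.* (P ℤ.- 1ℤ) → + 2 ℤ.* y ≡ m ℤ.* (m ℤ.- 1ℤ) →
  + 2 ℤ.* x₂ ≡ n ℤ.* (n ℤ.- 1ℤ) → + 6 ℤ.* x₃ ≡ n ℤ.* (n ℤ.- 1ℤ) ℤ.* (n ℤ.- + 2) →
  n ℤ.* (x₂ ℤ.* m ℤ.+ n ℤ.* (y ℤ.- γ) ℤ.+ γ ℤ.* n ℤ.* n) ℤ.+ x₂ ℤ.* (n ℤ.* m) ℤ.+ x₃ ≡
  P₂ ℤ.* x₂ ℤ.+ P ℤ.* P ℤ.* x₃ ℤ.+ m ℤ.* (P ℤ.* x₂) ℤ.+ y ℤ.* n ℤ.- a ℤ.* (n ℤ.- 1ℤ) ℤ.* n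
quadratic-coefficients m γ a P P₂ y n x₂ x₃ hγ ha refl hP₂ hy hx₂ hx₃ = ℤₚ.*-cancelˡ-≡ (+ 12) _ _ (begin
  + 12 ℤ.* (n ℤ.* (x₂ ℤ.* m ℤ.+ n ℤ.* (y ℤ.- γ) ℤ.+ γ ℤ.* n ℤ.* n) ℤ.+ x₂ ℤ.* (n ℤ.* m) ℤ.+ x₃)
    ≡⟨ Solver.scaleˡ m γ y n x₂ x₃ ⟩
  lhs (+ 2 ℤ.* x₂) (+ 6 ℤ.* x₃) (+ 2 ℤ.* y) (+ 3 ℤ.* γ)
    ≡⟨ trans (cong₂ (λ u v → lhs u v (+ 2 ℤ.* y) (+ 3 ℤ.* γ)) hx₂ hx₃) (cong₂ (lhs X₂ X₃) hy hγ) ⟩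
  lhs X₂ X₃ (m ℤ.* (m ℤ.- 1ℤ)) (m ℤ.* (+ 2 ℤ.* m ℤ.- 1ℤ))
    ≡⟨ Solver.identity m n ⟩
  rhs X₂ X₃ (m ℤ.* (m ℤ.- 1ℤ)) (P ℤ.* (P ℤ.- 1ℤ)) (m ℤ.* (m ℤ.+ 1ℤ))
    ≡⟨ trans (cong₂ (λ u v → rhs u v (+ 2 ℤ.* y) (+ 2 ℤ.* P₂) (+ 6 ℤ.* a)) hx₂ hx₃)
         (trans (cong₂ (λ u v → rhs X₂ X₃ u v (+ 6 ℤ.* a)) hy hP₂)
           (cong (rhs X₂ X₃ (m ℤ.* (m ℤ.- 1ℤ)) (P ℤ.* (P ℤ.- 1ℤ))) ha)) ⟨
  rhs (+ 2 ℤ.* x₂) (+ 6 ℤ.* x₃) (+ 2 ℤ.* y) (+ 2 ℤ.* P₂) (+ 6 ℤ.* a)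
    ≡⟨ Solver.scaleʳ m a P P₂ y n x₂ x₃ ⟨
  + 12 ℤ.* (P₂ ℤ.* x₂ ℤ.+ P ℤ.* P ℤ.* x₃ ℤ.+ m ℤ.* (P ℤ.* x₂) ℤ.+ y ℤ.* n ℤ.- a ℤ.* (n ℤ.- 1ℤ) ℤ.* n) ∎)
  where
  open ≡-Reasoning
  X₂ = n ℤ.* (n ℤ.- 1ℤ)
  X₃ = n ℤ.* (n ℤ.- 1ℤ) ℤ.* (n ℤ.- + 2)
  -- Twelve times each side, as a function of 2x₂, 6x₃, 2y, 3γ and of 2x₂, 6x₃, 2y, 2P₂, 6a: exactly
  -- the multiples that the hypotheses evaluate.
  lhs : ℤ → ℤ → ℤ → ℤ → ℤ
  lhs u v w z = n ℤ.* (+ 6 ℤ.* u ℤ.* m ℤ.+ n ℤ.* (+ 6 ℤ.* w ℤ.- + 4 ℤ.* z) ℤ.+ + 4 ℤ.* z ℤ.* n ℤ.* n)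
    ℤ.+ + 6 ℤ.* u ℤ.* (n ℤ.* m) ℤ.+ + 2 ℤ.* v
  rhs : ℤ → ℤ → ℤ → ℤ → ℤ → ℤ
  rhs u v w z b = + 3 ℤ.* z ℤ.* u ℤ.+ P ℤ.* P ℤ.* (+ 2 ℤ.* v) ℤ.+ m ℤ.* (P ℤ.* (+ 6 ℤ.* u))
    ℤ.+ + 6 ℤ.* w ℤ.* n ℤ.- + 2 ℤ.* b ℤ.* (n ℤ.- 1ℤ) ℤ.* n
  module Solver where
    scaleˡ : ∀ m γ y n x₂ x₃ →
      + 12 ℤ.* (n ℤ.* (x₂ ℤ.* m ℤ.+ n ℤ.* (y ℤ.- γ) ℤ.+ γ ℤ.* n ℤ.* n) ℤ.+ x₂ ℤ.* (n ℤ.* m) ℤ.+ x₃) ≡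
      n ℤ.* (+ 6 ℤ.* (+ 2 ℤ.* x₂) ℤ.* m ℤ.+ n ℤ.* (+ 6 ℤ.* (+ 2 ℤ.* y) ℤ.- + 4 ℤ.* (+ 3 ℤ.* γ)) ℤ.+ + 4
          ℤ.* (+ 3 ℤ.* γ) ℤ.* n ℤ.* n)
        ℤ.+ + 6 ℤ.* (+ 2 ℤ.* x₂) ℤ.* (n ℤ.* m) ℤ.+ + 2 ℤ.* (+ 6 ℤ.* x₃)
    scaleˡ = ℤSolver.solve-∀
    scaleʳ : ∀ m a P P₂ y n x₂ x₃ →
      + 12 ℤ.* (P₂ ℤ.* x₂ ℤ.+ P ℤ.* P ℤ.* x₃ ℤ.+ m ℤ.* (P ℤ.* x₂) ℤ.+ y ℤ.* n ℤ.- a ℤ.* (n ℤ.- 1ℤ) ℤ.* n) ≡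
      + 3 ℤ.* (+ 2 ℤ.* P₂) ℤ.* (+ 2 ℤ.* x₂) ℤ.+ P ℤ.* P ℤ.* (+ 2 ℤ.* (+ 6 ℤ.* x₃)) ℤ.+ m
          ℤ.* (P ℤ.* (+ 6 ℤ.* (+ 2 ℤ.* x₂)))
        ℤ.+ + 6 ℤ.* (+ 2 ℤ.* y) ℤ.* n ℤ.- + 2 ℤ.* (+ 6 ℤ.* a) ℤ.* (n ℤ.- 1ℤ) ℤ.* n
    scaleʳ = ℤSolver.solve-∀
    identity : ∀ m n → let P = 1ℤ ℤ.+ + 2 ℤ.* m; u = n ℤ.* (n ℤ.- 1ℤ); v = n ℤ.* (n ℤ.- 1ℤ) ℤ.* (n ℤ.- + 2)
                           w = m ℤ.* (m ℤ.- 1ℤ); z = m ℤ.* (+ 2 ℤ.* m ℤ.- 1ℤ) in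
      n ℤ.* (+ 6 ℤ.* u ℤ.* m ℤ.+ n ℤ.* (+ 6 ℤ.* w ℤ.- + 4 ℤ.* z) ℤ.+ + 4 ℤ.* z ℤ.* n ℤ.* n)
        ℤ.+ + 6 ℤ.* u ℤ.* (n ℤ.* m) ℤ.+ + 2 ℤ.* v ≡
      + 3 ℤ.* (P ℤ.* (P ℤ.- 1ℤ)) ℤ.* u ℤ.+ P ℤ.* P ℤ.* (+ 2 ℤ.* v) ℤ.+ m ℤ.* (P ℤ.* (+ 6 ℤ.* u))
        ℤ.+ + 6 ℤ.* w ℤ.* n ℤ.- + 2 ℤ.* (m ℤ.* (m ℤ.+ 1ℤ)) ℤ.* (n ℤ.- 1ℤ) ℤ.* n
    identity = ℤSolver.solve-∀

-- The corresponding comparison of the coefficients of t: n² = 2 C(n,2) + n together with p = 1 +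
-- 2m.
linear-coefficients : ∀ (m P n x₂ : ℤ) → P ≡ 1ℤ ℤ.+ + 2 ℤ.* m → + 2 ℤ.* x₂ ≡ n ℤ.* (n ℤ.- 1ℤ) →
  n ℤ.* (n ℤ.* m) ℤ.+ x₂ ≡ P ℤ.* x₂ ℤ.+ m ℤ.* n
linear-coefficients m P n x₂ refl hx₂ = begin
  n ℤ.* (n ℤ.* m) ℤ.+ x₂                          ≡⟨ Solver.split m n x₂ ⟩
  n ℤ.* (n ℤ.- 1ℤ) ℤ.* m ℤ.+ x₂ ℤ.+ m ℤ.* n       ≡⟨ cong (λ u → u ℤ.* m ℤ.+ x₂ ℤ.+ m ℤ.* n) hx₂ ⟨
  + 2 ℤ.* x₂ ℤ.* m ℤ.+ x₂ ℤ.+ m ℤ.* n             ≡⟨ Solver.collect m n x₂ ⟩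
  (1ℤ ℤ.+ + 2 ℤ.* m) ℤ.* x₂ ℤ.+ m ℤ.* n           ∎
  where
  open ≡-Reasoning
  module Solver where
    split : ∀ m n x → n ℤ.* (n ℤ.* m) ℤ.+ x ≡ n ℤ.* (n ℤ.- 1ℤ) ℤ.* m ℤ.+ x ℤ.+ m ℤ.* n
    split = ℤSolver.solve-∀
    collect : ∀ m n x → + 2 ℤ.* x ℤ.* m ℤ.+ x ℤ.+ m ℤ.* n ≡ (1ℤ ℤ.+ + 2 ℤ.* m) ℤ.* x ℤ.+ m ℤ.* n
    collect = ℤSolver.solve-∀

-- The block products modulo [p]³

module Blocks (m : ℕ) (prime : Prime (suc (m ℕ.+ m))) (γ a : ℤ)
  (3γ≡ : + 3 ℤ.* γ ≡ + m ℤ.* (+ 2 ℤ.* + m ℤ.- 1ℤ)) (6a≡ : + 6 ℤ.* a ≡ + m ℤ.* (+ m ℤ.+ 1ℤ)) where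

  n = m ℕ.+ m
  open PrimeModulus n prime using (p; φ; φ₀≡1; q^p≋1; v-coeff≋binom)

  Q t Φ : Poly
  Q = q ^ p
  t = Q + - 1#
  Φ = φ ^ 3

  open Congruence Φ public
  module Modφ = Congruence φ

  +p≡ : + p ≡ 1ℤ ℤ.+ + 2 ℤ.* + m
  +p≡ = cong (λ x → 1ℤ ℤ.+ x) (Solver.double (+ m))
    where
    module Solver where
      double : ∀ x → x ℤ.+ x ≡ + 2 ℤ.* x
      double = ℤSolver.solve-∀

  -- Having p as a factor lets the quadratic coefficient be written as γ e₀ modulo [p], since e₀ ≡ p
  -- there; then e₀ divides out of the whole expansion.
  binom-p-3 : binom p 3 ≡ γ ℤ.* + p
  binom-p-3 = ℤₚ.*-cancelˡ-≡ (+ 6) _ _ (begin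
    + 6 ℤ.* binom p 3                          ≡⟨ 6*binom-3 p ⟩
    + p ℤ.* (+ p ℤ.- 1ℤ) ℤ.* (+ p ℤ.- + 2)     ≡⟨ cong (λ x → + p ℤ.* (x ℤ.- 1ℤ) ℤ.* (x ℤ.- + 2)) +p≡ ⟩
    + p ℤ.* (1ℤ ℤ.+ + 2 ℤ.* + m ℤ.- 1ℤ) ℤ.* (1ℤ ℤ.+ + 2 ℤ.* + m ℤ.- + 2)
      ≡⟨ Solver.regroup (+ p) (+ m) ⟩
    + 2 ℤ.* (+ m ℤ.* (+ 2 ℤ.* + m ℤ.- 1ℤ)) ℤ.* + p ≡⟨ cong (λ x → + 2 ℤ.* x ℤ.* + p) 3γ≡ ⟨
    + 2 ℤ.* (+ 3 ℤ.* γ) ℤ.* + p                ≡⟨ Solver.collect (+ p) γ ⟩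
    + 6 ℤ.* (γ ℤ.* + p)                        ∎)
    where
    open ≡-Reasoning
    module Solver where
      regroup : ∀ p m → p ℤ.* (1ℤ ℤ.+ + 2 ℤ.* m ℤ.- 1ℤ) ℤ.* (1ℤ ℤ.+ + 2 ℤ.* m ℤ.- + 2) ≡
        + 2 ℤ.* (m ℤ.* (+ 2 ℤ.* m ℤ.- 1ℤ)) ℤ.* p
      regroup = ℤSolver.solve-∀
      collect : ∀ p γ → + 2 ℤ.* (+ 3 ℤ.* γ) ℤ.* p ≡ + 6 ℤ.* (γ ℤ.* p)
      collect = ℤSolver.solve-∀

  t≈ : t ≈ (q + - 1#) * φ
  t≈ = ≈-trans (+-cong (geo-telescope q p) (≈-refl { - 1#})) (Solver.drop ((q + - 1#) * φ))
    where
    module Solver where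
      drop : ∀ x → 1# + x + - 1# ≈ x
      drop = solve-∀ polyRing

  Q≈1+t : Q ≈ 1# + t
  Q≈1+t = Solver.add Q
    where
    module Solver where
      add : ∀ x → x ≈ 1# + (x + - 1#)
      add = solve-∀ polyRing

  t³≋0 : t * t * t ≋ 0#
  t³≋0 = ∣⇒≋0 (y * y * y , ≈-sym (≈-trans (*-cong (*-cong t≈ t≈) t≈) (Solver.regroup y φ)))
    where
    y = q + - 1#
    module Solver where
      regroup : ∀ y f → y * f * (y * f) * (y * f) ≈ y * y * y * (f * (f * (f * 1#)))
      regroup = solve-∀ polyRing

  open Jets Φ t t³≋0 public

  -- t = (q - 1) [p], so t² supplies the two missing factors [p].
  ≋φ⇒≋-*t² : ∀ {f g} → f Modφ.≋ g → f * (t * t) ≋ g * (t * t)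
  ≋φ⇒≋-*t² {f} {g} (Congruence.mk≋ c f≈) = mk≋ (c * (y * y)) (begin
    f * (t * t)                       ≈⟨ *-congʳ (t * t) f≈ ⟩
    (g + c * φ) * (t * t)             ≈⟨ *-distribʳ-+ (t * t) g (c * φ) ⟩
    g * (t * t) + c * φ * (t * t)     ≈⟨ +-cong (≈-refl {g * (t * t)}) (*-congˡ (c * φ) (*-cong t≈ t≈)) ⟩
    g * (t * t) + c * φ * (y * φ * (y * φ)) ≈⟨ Solver.regroup (g * (t * t)) c y φ ⟩
    g * (t * t) + c * (y * y) * Φ     ∎)
    where
    open SetoidReasoning ≈-setoid
    y = q + - 1#
    module Solver where
      regroup : ∀ x c y f → x + c * f * (y * f * (y * f)) ≈ x + c * (y * y) * (f * (f * (f * 1#)))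
      regroup = solve-∀ polyRing

  e₀ e₁ e₂ M : Poly
  e₀ = v-coeff n 0
  e₁ = v-coeff n 1
  e₂ = v-coeff n 2
  M  = Q ^ m

  e₀≋p : e₀ Modφ.≋ const (+ p)
  e₀≋p = Modφ.≋-trans (v-coeff≋binom 0) (Modφ.≈⇒≋ (CommutativeRing.reflexive ℤ[q] (cong const (binom-1 p))))

  e₂t²≋ : e₂ * (t * t) ≋ const γ * e₀ * (t * t)
  e₂t²≋ = ≋φ⇒≋-*t² (begin
    e₂                      ≈⟨ v-coeff≋binom 2 ⟩
    const (binom p 3)       ≡⟨ cong const binom-p-3 ⟩
    const (γ ℤ.* + p)       ≈⟨ Modφ.≈⇒≋ (const-* γ (+ p)) ⟩
    const γ * const (+ p)   ≈⟨ Modφ.≋-*ˡ (const γ) e₀≋p ⟨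
    const γ * e₀            ∎)
    where open SetoidReasoning Modφ.≋-setoid

  K≋ : ∀ j → K m j ≋ e₀ + e₁ * t * geo Q j + e₂ * (t * t) * (geo Q j * geo Q j)
  K≋ j = ≋-trans (≈⇒≋ (≈-trans K≈
      (≈-trans expansion (≈-trans substituted (Solver.regroup t g e₀ e₁ e₂ r)))))
    (≋-trans (≋-+ˡ main (≋-*ˡ (r * (g * g * g)) t³≋0)) (≈⇒≋ (Solver.drop main (r * (g * g * g)))))
    where
    g = geo Q j
    -- Q^j - q^i = (1 - q^i) + v, and v = t [j]_Q brings in the factor t.
    v = q ^ (j ℕ.* p) + - 1#
    main = e₀ + e₁ * t * g + e₂ * (t * t) * (g * g)
    r = ×.proj₁ (prod-expansion n v)
    expansion : prod (λ i → 1# + - (q ^ i) + v) n ≈ e₀ + e₁ * v + e₂ * (v * v) + r * (v * v * v)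
    expansion = ×.proj₂ (prod-expansion n v)
    module Solver where
      shift : ∀ x y → x + - y ≈ 1# + - y + (x + - 1#)
      shift = solve-∀ polyRing
      drop1 : ∀ x → 1# + x + - 1# ≈ x
      drop1 = solve-∀ polyRing
      regroup : ∀ t g e₀ e₁ e₂ r →
        e₀ + e₁ * (t * g) + e₂ * (t * g * (t * g)) + r * (t * g * (t * g) * (t * g)) ≈
        e₀ + e₁ * t * g + e₂ * (t * t) * (g * g) + r * (g * g * g) * (t * t * t)
      regroup = solve-∀ polyRing
      drop : ∀ x y → x + y * 0# ≈ x
      drop = solve-∀ polyRing
    K≈ : K m j ≈ prod (λ i → 1# + - (q ^ i) + v) n
    K≈ = prod-cong n (λ i → Solver.shift (q ^ (j ℕ.* p)) (q ^ i))
    v≈ : v ≈ t * g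
    v≈ = ≈-trans (+-cong (q^[*p]≈ m j) (≈-refl { - 1#})) (Solver.drop1 (t * g))
    substituted : e₀ + e₁ * v + e₂ * (v * v) + r * (v * v * v) ≈
      e₀ + e₁ * (t * g) + e₂ * (t * g * (t * g)) + r * (t * g * (t * g) * (t * g))
    substituted = +-cong (+-cong (+-cong (≈-refl {e₀}) (*-congˡ e₁ v≈)) (*-congˡ e₂ (*-cong v≈ v≈)))
      (*-congˡ r (*-cong (*-cong v≈ v≈) v≈))

  K-1 : K m 1 ≈ M * e₀
  K-1 = ≈-trans (K-suc m 0) (*-congˡ M (≈-sym (≈-trans (v-coeff₀≈prod n)
    (prod-cong n (λ i → CommutativeRing.reflexive ℤ[q]
        (cong (λ k → 1# + - (q ^ k)) (sym (ℕₚ.+-identityʳ i))))))))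

  -- K m 1 is both q^{pm} e₀ and a value of the expansion K≋, which determines e₁ modulo φ².
  e₁t≋ : e₁ * t ≋ M * e₀ + - e₀ + - (const γ * e₀ * (t * t))
  e₁t≋ = begin
    e₁ * t
      ≈⟨ ≈⇒≋ (Solver.isolate e₀ (e₁ * t) (e₂ * (t * t))) ⟩
    e₀ + e₁ * t * 1# + e₂ * (t * t) * (1# * 1#) + - e₀ + - (e₂ * (t * t))
      ≈⟨ ≋-+ (≋-+ʳ (- e₀) (≋-trans (≋-sym (K≋ 1)) (≈⇒≋ K-1))) (≋-neg e₂t²≋) ⟩
    M * e₀ + - e₀ + - (const γ * e₀ * (t * t)) ∎
    where
    open SetoidReasoning ≋-setoid
    module Solver where
      isolate : ∀ x y z → y ≈ x + y * 1# + z * (1# * 1#) + - x + - z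
      isolate = solve-∀ polyRing

  -- K_j divided by e₀. Unlike e₀ itself, this is an integer polynomial in Q, so its Taylor
  -- coefficients in t are explicit.
  θ : ℕ → Poly
  θ j = 1# + geo Q j * (M + - 1# + - (const γ * (t * t))) + const γ * (t * t) * (geo Q j * geo Q j)

  K≋e₀θ : ∀ j → K m j ≋ e₀ * θ j
  K≋e₀θ j = begin
    K m j
      ≈⟨ K≋ j ⟩
    e₀ + e₁ * t * g + e₂ * (t * t) * (g * g)
      ≈⟨ ≋-+ (≋-+ˡ e₀ (≋-*ʳ g e₁t≋)) (≋-*ʳ (g * g) e₂t²≋) ⟩
    e₀ + (M * e₀ + - e₀ + - (const γ * e₀ * (t * t))) * g + const γ * e₀ * (t * t) * (g * g)
      ≈⟨ ≈⇒≋ (Solver.factor e₀ M (const γ) t g) ⟩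
    e₀ * θ j ∎
    where
    open SetoidReasoning ≋-setoid
    g = geo Q j
    module Solver where
      factor : ∀ e M γ t g →
        e + (M * e + - e + - (γ * e * (t * t))) * g + γ * e * (t * t) * (g * g) ≈
        e * (1# + g * (M + - 1# + - (γ * (t * t))) + γ * (t * t) * (g * g))
      factor = solve-∀ polyRing

  T : Poly
  T = Q ^ p

  ψ : ℕ → Poly
  ψ j = 1# + - (const (a ℤ.* (binom j 1 ℤ.- 1ℤ)) * (t * t))

  jet-Q : Jet Q 1ℤ 1ℤ 0ℤ
  jet-Q = jet-≈ Q≈1+t jet-1+t

  jet-gQ : ∀ j → Jet (geo Q j) (binom j 1) (binom j 2) (binom j 3)
  jet-gQ j = jet-resp refl (ℤₚ.*-identityˡ _) (Solver.simplify (binom j 2) (binom j 3)) (jet-geo jet-Q j)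
    where
    module Solver where
      simplify : ∀ x y → 0ℤ ℤ.* x ℤ.+ 1ℤ ℤ.* 1ℤ ℤ.* y ≡ y
      simplify = ℤSolver.solve-∀

  jet-Q^ : ∀ j → Jet (Q ^ j) 1ℤ (binom j 1) (binom j 2)
  jet-Q^ j = jet-resp refl (ℤₚ.*-identityˡ _) (Solver.simplify (binom j 1) (binom j 2)) (jet-^ jet-Q j)
    where
    module Solver where
      simplify : ∀ x y → 0ℤ ℤ.* x ℤ.+ 1ℤ ℤ.* 1ℤ ℤ.* y ≡ y
      simplify = ℤSolver.solve-∀

  jet-θ : ∀ j → Jet (θ j) 1ℤ (binom j 1 ℤ.* binom m 1)
    (binom j 2 ℤ.* binom m 1 ℤ.+ binom j 1 ℤ.* (binom m 2 ℤ.- γ) ℤ.+ γ ℤ.* binom j 1 ℤ.* binom j 1)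
  jet-θ j = jet-resp (Solver.constant N) (Solver.linear N X₂ μ) (Solver.quadratic γ N X₂ X₃ μ Y)
    (jet-+ (jet-+ (jet-const 1ℤ) (jet-* (jet-gQ j) jet-M-1-γt²))
        (jet-* (jet-const*t² γ) (jet-* (jet-gQ j) (jet-gQ j))))
    where
    N = binom j 1
    X₂ = binom j 2
    X₃ = binom j 3
    μ = binom m 1
    Y = binom m 2
    module Solver where
      M₁ : ∀ μ → μ ℤ.+ 0ℤ ℤ.+ 0ℤ ≡ μ
      M₁ = ℤSolver.solve-∀
      M₂ : ∀ γ Y → Y ℤ.+ 0ℤ ℤ.+ ℤ.- γ ≡ Y ℤ.- γ
      M₂ = ℤSolver.solve-∀
      constant : ∀ N → 1ℤ ℤ.+ N ℤ.* 0ℤ ℤ.+ 0ℤ ℤ.* (N ℤ.* N) ≡ 1ℤ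
      constant = ℤSolver.solve-∀
      linear : ∀ N X₂ μ →
        0ℤ ℤ.+ (N ℤ.* μ ℤ.+ X₂ ℤ.* 0ℤ) ℤ.+ (0ℤ ℤ.* (N ℤ.* X₂ ℤ.+ X₂ ℤ.* N) ℤ.+ 0ℤ ℤ.* (N ℤ.* N)) ≡ N ℤ.* μ
      linear = ℤSolver.solve-∀
      quadratic : ∀ γ N X₂ X₃ μ Y →
        0ℤ ℤ.+ (N ℤ.* (Y ℤ.- γ) ℤ.+ X₂ ℤ.* μ ℤ.+ X₃ ℤ.* 0ℤ)
          ℤ.+ (0ℤ ℤ.* (N ℤ.* X₃ ℤ.+ X₂ ℤ.* X₂ ℤ.+ X₃ ℤ.* N) ℤ.+ 0ℤ ℤ.* (N ℤ.* X₂ ℤ.+ X₂ ℤ.* N) ℤ.+ γ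
              ℤ.* (N ℤ.* N)) ≡
        X₂ ℤ.* μ ℤ.+ N ℤ.* (Y ℤ.- γ) ℤ.+ γ ℤ.* N ℤ.* N
      quadratic = ℤSolver.solve-∀
    jet-M-1-γt² : Jet (M + - 1# + - (const γ * (t * t))) 0ℤ μ (Y ℤ.- γ)
    jet-M-1-γt² = jet-resp refl (Solver.M₁ μ) (Solver.M₂ γ Y)
      (jet-+ (jet-+ (jet-Q^ m) (jet-neg (jet-const 1ℤ))) (jet-neg (jet-const*t² γ)))

  jet-ψ : ∀ j → Jet (ψ j) 1ℤ 0ℤ (ℤ.- (a ℤ.* (binom j 1 ℤ.- 1ℤ)))
  jet-ψ j = jet-resp refl refl (ℤₚ.+-identityˡ _)
    (jet-+ (jet-const 1ℤ) (jet-neg (jet-const*t² (a ℤ.* (binom j 1 ℤ.- 1ℤ)))))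

  -- Both sides have constant coefficient j. The linear coefficients agree because p = 2m + 1, and
  -- `ψ` absorbs the discrepancy of the quadratic ones.
  geo*θ≋ : ∀ j → geo Q j * θ j ≋ M * (geo T j * ψ j)
  geo*θ≋ j = jet-unique
    (sym (ℤₚ.*-identityˡ (N ℤ.* 1ℤ)))
    (trans (Solver.linearˡ N X₂ μ) (trans (linear-coefficients μ P N X₂ hP (triangular j))
        (Solver.linearʳ N X₂ μ P)))
    (trans (Solver.quadraticˡ N X₂ X₃ μ (X₂ ℤ.* μ ℤ.+ N ℤ.* (Y ℤ.- γ) ℤ.+ γ ℤ.* N ℤ.* N))
      (trans (quadratic-coefficients μ γ a P P₂ Y N X₂ X₃ hγ ha hP (triangular p) (triangular m)
          (triangular j) hX₃)
        (Solver.quadraticʳ a N X₂ X₃ μ Y P P₂)))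
    (jet-* (jet-gQ j) (jet-θ j))
    (jet-* (jet-Q^ m) (jet-* (jet-geo (jet-Q^ p) j) (jet-ψ j)))
    where
    N = binom j 1
    X₂ = binom j 2
    X₃ = binom j 3
    μ = binom m 1
    Y = binom m 2
    P = binom p 1
    P₂ = binom p 2
    hγ : + 3 ℤ.* γ ≡ μ ℤ.* (+ 2 ℤ.* μ ℤ.- 1ℤ)
    hγ = trans 3γ≡ (cong (λ x → x ℤ.* (+ 2 ℤ.* x ℤ.- 1ℤ)) (sym (binom-1 m)))
    ha : + 6 ℤ.* a ≡ μ ℤ.* (μ ℤ.+ 1ℤ)
    ha = trans 6a≡ (cong (λ x → x ℤ.* (x ℤ.+ 1ℤ)) (sym (binom-1 m)))
    hP : P ≡ 1ℤ ℤ.+ + 2 ℤ.* μ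
    hP = trans (binom-1 p) (trans +p≡ (cong (λ x → 1ℤ ℤ.+ + 2 ℤ.* x) (sym (binom-1 m))))
    triangular : ∀ k → + 2 ℤ.* binom k 2 ≡ binom k 1 ℤ.* (binom k 1 ℤ.- 1ℤ)
    triangular k = trans (2*binom-2 k) (cong (λ x → x ℤ.* (x ℤ.- 1ℤ)) (sym (binom-1 k)))
    hX₃ : + 6 ℤ.* X₃ ≡ N ℤ.* (N ℤ.- 1ℤ) ℤ.* (N ℤ.- + 2)
    hX₃ = trans (6*binom-3 j) (cong (λ x → x ℤ.* (x ℤ.- 1ℤ) ℤ.* (x ℤ.- + 2)) (sym (binom-1 j)))
    module Solver where
      linearˡ : ∀ N X₂ μ → N ℤ.* (N ℤ.* μ) ℤ.+ X₂ ℤ.* 1ℤ ≡ N ℤ.* (N ℤ.* μ) ℤ.+ X₂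
      linearˡ = ℤSolver.solve-∀
      linearʳ : ∀ N X₂ μ P → P ℤ.* X₂ ℤ.+ μ ℤ.* N ≡
        1ℤ ℤ.* (N ℤ.* 0ℤ ℤ.+ P ℤ.* X₂ ℤ.* 1ℤ) ℤ.+ μ ℤ.* (N ℤ.* 1ℤ)
      linearʳ = ℤSolver.solve-∀
      quadraticˡ : ∀ N X₂ X₃ μ z → N ℤ.* z ℤ.+ X₂ ℤ.* (N ℤ.* μ) ℤ.+ X₃ ℤ.* 1ℤ ≡
          N ℤ.* z ℤ.+ X₂ ℤ.* (N ℤ.* μ) ℤ.+ X₃
      quadraticˡ = ℤSolver.solve-∀
      quadraticʳ : ∀ a N X₂ X₃ μ Y P P₂ →
        P₂ ℤ.* X₂ ℤ.+ P ℤ.* P ℤ.* X₃ ℤ.+ μ ℤ.* (P ℤ.* X₂) ℤ.+ Y ℤ.* N ℤ.- a ℤ.* (N ℤ.- 1ℤ) ℤ.* N ≡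
        1ℤ ℤ.* (N ℤ.* ℤ.- (a ℤ.* (N ℤ.- 1ℤ)) ℤ.+ P ℤ.* X₂ ℤ.* 0ℤ ℤ.+ (P₂ ℤ.* X₂ ℤ.+ P ℤ.* P ℤ.* X₃) ℤ.* 1ℤ)
          ℤ.+ μ ℤ.* (N ℤ.* 0ℤ ℤ.+ P ℤ.* X₂ ℤ.* 1ℤ) ℤ.+ Y ℤ.* (N ℤ.* 1ℤ)
      quadraticʳ = ℤSolver.solve-∀

  -- The product of ψ 1, ..., ψ l up to t³: the terms linear in a add up by 0 + 1 + ⋯ + (l-1) =
  -- C(l,2), all others contain t⁴.
  Ψ : ℕ → Poly
  Ψ l = 1# + - (const (a ℤ.* binom l 2) * (t * t))

  jet-Ψ : ∀ l → Jet (Ψ l) 1ℤ 0ℤ (ℤ.- (a ℤ.* binom l 2))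
  jet-Ψ l = jet-resp refl refl (ℤₚ.+-identityˡ _)
    (jet-+ (jet-const 1ℤ) (jet-neg (jet-const*t² (a ℤ.* binom l 2))))

  prod-K≋ : ∀ l → prod (λ j → geo Q j * K m j) l ≋ (e₀ * M) ^ l * (prod (geo T) l * Ψ l)
  prod-K≋ zero    = ≋-trans (jet-unique refl refl (Solver.base a) (jet-const 1ℤ) (jet-Ψ 0))
    (≈⇒≋ (≈-sym (≈-trans (*-identityˡ (1# * Ψ 0)) (*-identityˡ (Ψ 0)))))
    where
    module Solver where
      base : ∀ a → 0ℤ ≡ ℤ.- (a ℤ.* 0ℤ)
      base = ℤSolver.solve-∀
  prod-K≋ (suc l) = begin
    geo Q (suc l) * K m (suc l) * prod (λ j → geo Q j * K m j) l
      ≈⟨ ≋-* (≋-*ˡ (geo Q (suc l)) (K≋e₀θ (suc l))) (prod-K≋ l) ⟩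
    geo Q (suc l) * (e₀ * θ (suc l)) * (E ^ l * (U * Ψ l))
      ≈⟨ ≈⇒≋ (Solver.regroup (geo Q (suc l)) e₀ (θ (suc l)) (E ^ l * (U * Ψ l))) ⟩
    e₀ * (geo Q (suc l) * θ (suc l)) * (E ^ l * (U * Ψ l))
      ≈⟨ ≋-*ʳ (E ^ l * (U * Ψ l)) (≋-*ˡ e₀ (geo*θ≋ (suc l))) ⟩
    e₀ * (M * (geo T (suc l) * ψ (suc l))) * (E ^ l * (U * Ψ l))
      ≈⟨ ≈⇒≋ (Solver.regroup′ e₀ M (geo T (suc l)) (ψ (suc l)) (E ^ l) U (Ψ l)) ⟩
    E * E ^ l * (geo T (suc l) * U * (ψ (suc l) * Ψ l))
      ≈⟨ ≋-*ˡ (E * E ^ l) (≋-*ˡ (geo T (suc l) * U)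
          (jet-unique refl refl (Solver.coefficient a (binom l 1) (binom l 2))
           (jet-* (jet-ψ (suc l)) (jet-Ψ l)) (jet-Ψ (suc l)))) ⟩
    E * E ^ l * (geo T (suc l) * U * Ψ (suc l)) ∎
    where
    open SetoidReasoning ≋-setoid
    E = e₀ * M
    U = prod (geo T) l
    module Solver where
      regroup : ∀ g e θ x → g * (e * θ) * x ≈ e * (g * θ) * x
      regroup = solve-∀ polyRing
      regroup′ : ∀ e M g ψ x u y → e * (M * (g * ψ)) * (x * (u * y)) ≈ e * M * x * (g * u * (ψ * y))
      regroup′ = solve-∀ polyRing
      coefficient : ∀ a k l → 1ℤ ℤ.* ℤ.- (a ℤ.* l) ℤ.+ 0ℤ ℤ.* 0ℤ ℤ.+ ℤ.- (a ℤ.* (1ℤ ℤ.+ k ℤ.- 1ℤ)) ℤ.* 1ℤ ≡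
        ℤ.- (a ℤ.* (k ℤ.+ l))
      coefficient = ℤSolver.solve-∀

-- Substitution is a ring homomorphism

[↦]-zero : ∀ {f} g → f ≈ 0# → f [q↦ g ] ≈ 0#
[↦]-zero {[]}    g e = ≈-refl
[↦]-zero {a ∷ f} g e = ≈-trans (+-cong (≈-trans (∷-cong (at e 0) ≈-refl) 0∷[]≈[])
  (*-congˡ g ([↦]-zero {f} g (≈-tail₀ e)))) (*-zeroʳ g)

[↦]-cong : ∀ {f f′} g → f ≈ f′ → f [q↦ g ] ≈ f′ [q↦ g ]
[↦]-cong {[]}    {f′}     g e = ≈-sym ([↦]-zero g (≈-sym e))
[↦]-cong {a ∷ f} {[]}     g e = [↦]-zero {a ∷ f} g e
[↦]-cong {a ∷ f} {b ∷ f′} g e = +-cong (∷-cong (≈-head e) ≈-refl) (*-congˡ g ([↦]-cong g (≈-tail e)))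

[↦]-congʳ : ∀ f {g g′} → g ≈ g′ → f [q↦ g ] ≈ f [q↦ g′ ]
[↦]-congʳ []      e = ≈-refl
[↦]-congʳ (a ∷ f) e = +-cong (≈-refl {const a}) (*-cong e ([↦]-congʳ f e))

[↦]-+ : ∀ f f′ g → (f + f′) [q↦ g ] ≈ f [q↦ g ] + f′ [q↦ g ]
[↦]-+ []      f′       g = ≈-refl
[↦]-+ (a ∷ f) []       g = ≈-sym (+-identityʳ _)
[↦]-+ (a ∷ f) (b ∷ f′) g = ≈-trans (+-cong (const-+ a b) (*-congˡ g ([↦]-+ f f′ g)))
  (Solver.collect (const a) (const b) g (f [q↦ g ]) (f′ [q↦ g ]))
  where
  module Solver where
    collect : ∀ a b g x y → a + b + g * (x + y) ≈ (a + g * x) + (b + g * y)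
    collect = solve-∀ polyRing

[↦]-· : ∀ a f g → (a · f) [q↦ g ] ≈ const a * f [q↦ g ]
[↦]-· a []      g = ≈-sym 0∷[]≈[]
[↦]-· a (b ∷ f) g = ≈-trans (+-cong (const-* a b) (*-congˡ g ([↦]-· a f g)))
  (Solver.collect (const a) (const b) g (f [q↦ g ]))
  where
  module Solver where
    collect : ∀ a b g x → a * b + g * (a * x) ≈ a * (b + g * x)
    collect = solve-∀ polyRing

[↦]-* : ∀ f f′ g → (f * f′) [q↦ g ] ≈ f [q↦ g ] * f′ [q↦ g ]
[↦]-* []      f′ g = ≈-refl
[↦]-* (a ∷ f) f′ g = begin
  (a · f′ + (0ℤ ∷ f * f′)) [q↦ g ]
    ≈⟨ [↦]-+ (a · f′) (0ℤ ∷ f * f′) g ⟩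
  (a · f′) [q↦ g ] + (const 0ℤ + g * (f * f′) [q↦ g ])
    ≈⟨ +-cong ([↦]-· a f′ g) (+-cong 0∷[]≈[] (*-congˡ g ([↦]-* f f′ g))) ⟩
  const a * f′ [q↦ g ] + (0# + g * (f [q↦ g ] * f′ [q↦ g ]))
    ≈⟨ Solver.collect (const a) g (f [q↦ g ]) (f′ [q↦ g ]) ⟩
  (const a + g * f [q↦ g ]) * f′ [q↦ g ] ∎
  where
  open SetoidReasoning ≈-setoid
  module Solver where
    collect : ∀ a g x y → a * y + (0# + g * (x * y)) ≈ (a + g * x) * y
    collect = solve-∀ polyRing

[↦]-q^ : ∀ n g → (q ^ n) [q↦ g ] ≈ g ^ n
[↦]-q^ zero    g = ≈-trans (+-cong (≈-refl {1#}) (*-zeroʳ g)) (+-identityʳ 1#)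
[↦]-q^ (suc n) g = ≈-trans ([↦]-* q (q ^ n) g) (*-cong (Solver.q↦ g) ([↦]-q^ n g))
  where
  module Solver where
    q↦ : ∀ g → const 0ℤ + g * (1# + g * 0#) ≈ g
    q↦ = solve-∀ polyRing

[↦]-[]q : ∀ n g → [ n ]q [q↦ g ] ≈ geo g n
[↦]-[]q zero    g = ≈-refl
[↦]-[]q (suc n) g = ≈-trans ([↦]-+ [ n ]q (q ^ n) g) (+-cong ([↦]-[]q n g) ([↦]-q^ n g))

[↦]-!q : ∀ n g → [ n ]!q [q↦ g ] ≈ prod (geo g) n
[↦]-!q zero    g = [↦]-q^ 0 g
[↦]-!q (suc n) g = ≈-trans ([↦]-* [ suc n ]q [ n ]!q g) (*-cong ([↦]-[]q (suc n) g) ([↦]-!q n g))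

-- Factorial formulas for both kinds of binomial coefficients

qbinom-! : ∀ s r → qbinom (s ℕ.+ r) s * ([ s ]!q * [ r ]!q) ≈ [ s ℕ.+ r ]!q
qbinom-! s r = subst (λ i → qbinom (s ℕ.+ r) s * ([ s ]!q * [ i ]!q) ≈ [ s ℕ.+ r ]!q)
  (ℕₚ.m+n∸m≡n s r) (qbinom-quotient (ℕₚ.m≤m+n s r))

C-! : ∀ s r → ((s ℕ.+ r) C s) ℕ.* (s ! ℕ.* r !) ≡ (s ℕ.+ r) !
C-! s r = begin
  ((s ℕ.+ r) C s) ℕ.* (s ! ℕ.* r !)
      ≡⟨ cong (λ i → ((s ℕ.+ r) C s) ℕ.* (s ! ℕ.* i !)) (ℕₚ.m+n∸m≡n s r) ⟨
  ((s ℕ.+ r) C s) ℕ.* (s ! ℕ.* (s ℕ.+ r ℕ.∸ s) !)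
      ≡⟨ cong (ℕ._* (s ! ℕ.* (s ℕ.+ r ℕ.∸ s) !)) (nCk≡n!/k![n-k]! s≤s+r) ⟩
  (s ℕ.+ r) ! ℕ./ (s ! ℕ.* (s ℕ.+ r ℕ.∸ s) !) ℕ.* (s ! ℕ.* (s ℕ.+ r ℕ.∸ s) !)
                                                      ≡⟨ m/n*n≡m (k![n∸k]!∣n! s≤s+r) ⟩
  (s ℕ.+ r) !                                         ∎
  where
  open ≡-Reasoning
  s≤s+r = ℕₚ.m≤m+n s r
  instance _ = s ℕₚ.!* (s ℕ.+ r ℕ.∸ s) !≢0

C-suc : ∀ s r → ((s ℕ.+ r) C suc s) ℕ.* suc s ≡ ((s ℕ.+ r) C s) ℕ.* r
C-suc s zero    = trans (cong (ℕ._* suc s) (k>n⇒nCk≡0 (s≤s (ℕₚ.≤-reflexive (ℕₚ.+-identityʳ s)))))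
  (sym (ℕₚ.*-zeroʳ ((s ℕ.+ 0) C s)))
C-suc s (suc r) = ℕₚ.*-cancelʳ-≡ _ _ (s ! ℕ.* r !) {{s ℕₚ.!* r !≢0}} (begin
  A ℕ.* suc s ℕ.* (s ! ℕ.* r !)      ≡⟨ Solver.left A (suc s) (s !) (r !) ⟩
  A ℕ.* (suc s ! ℕ.* r !)
      ≡⟨ subst (λ k → (k C suc s) ℕ.* (suc s ! ℕ.* r !) ≡ k !) (sym (ℕₚ.+-suc s r)) (C-! (suc s) r) ⟩
  (s ℕ.+ suc r) !                    ≡⟨ C-! s (suc r) ⟨
  B ℕ.* (s ! ℕ.* suc r !)            ≡⟨ Solver.right B (suc r) (s !) (r !) ⟩
  B ℕ.* suc r ℕ.* (s ! ℕ.* r !)      ∎)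
  where
  open ≡-Reasoning
  A = (s ℕ.+ suc r) C suc s
  B = (s ℕ.+ suc r) C s
  module Solver where
    left : ∀ A k x y → A ℕ.* k ℕ.* (x ℕ.* y) ≡ A ℕ.* (k ℕ.* x ℕ.* y)
    left = ℕSolver.solve-∀
    right : ∀ B k x y → B ℕ.* (x ℕ.* (k ℕ.* y)) ≡ B ℕ.* k ℕ.* (x ℕ.* y)
    right = ℕSolver.solve-∀

2*[1+s]C2 : ∀ s → (suc s C 2) ℕ.* 2 ≡ suc s ℕ.* s
2*[1+s]C2 s = trans (C-suc 1 s) (cong (ℕ._* s) (C-1 (suc s)))
  where
  C-1 : ∀ n → n C 1 ≡ n
  C-1 n = trans (sym (ℕₚ.*-identityʳ (n C 1))) (trans (C-suc 0 n) (ℕₚ.*-identityˡ n))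

-- Translates the coefficient of the theorem, where `a ℕ.* 2` is (p²-1)/12, into the symmetric form
-- a s (k-s) C(k,s) that the block products give.
C-product : ∀ s r a → ((s ℕ.+ r) C suc s) ℕ.* (suc s C 2) ℕ.* (a ℕ.* 2) ≡
    ((s ℕ.+ r) C s) ℕ.* (a ℕ.* (s ℕ.* r))
C-product s r a = begin
  A ℕ.* (suc s C 2) ℕ.* (a ℕ.* 2)       ≡⟨ Solver.left A (suc s C 2) a ⟩
  A ℕ.* ((suc s C 2) ℕ.* 2) ℕ.* a       ≡⟨ cong (λ x → A ℕ.* x ℕ.* a) (2*[1+s]C2 s) ⟩
  A ℕ.* (suc s ℕ.* s) ℕ.* a             ≡⟨ Solver.middle A (suc s) s a ⟩
  A ℕ.* suc s ℕ.* s ℕ.* a               ≡⟨ cong (λ x → x ℕ.* s ℕ.* a) (C-suc s r) ⟩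
  B ℕ.* r ℕ.* s ℕ.* a                   ≡⟨ Solver.right B r s a ⟩
  B ℕ.* (a ℕ.* (s ℕ.* r))               ∎
  where
  open ≡-Reasoning
  A = (s ℕ.+ r) C suc s
  B = (s ℕ.+ r) C s
  module Solver where
    left : ∀ A x a → A ℕ.* x ℕ.* (a ℕ.* 2) ≡ A ℕ.* (x ℕ.* 2) ℕ.* a
    left = ℕSolver.solve-∀
    middle : ∀ A k s a → A ℕ.* (k ℕ.* s) ℕ.* a ≡ A ℕ.* k ℕ.* s ℕ.* a
    middle = ℕSolver.solve-∀
    right : ∀ B r s a → B ℕ.* r ℕ.* s ℕ.* a ≡ B ℕ.* (a ℕ.* (s ℕ.* r))
    right = ℕSolver.solve-∀

-- The integers attached to p

-- γ = (p-1)(p-2)/6 and a = (p²-1)/24; γ is an integer because 3 ∤ p.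

record Parameters (p : ℕ) : Set where
  field
    m a : ℕ
    γ   : ℤ
    p≡  : p ≡ suc (m ℕ.+ m)
    3γ≡ : + 3 ℤ.* γ ≡ + m ℤ.* (+ 2 ℤ.* + m ℤ.- 1ℤ)
    6a≡ : 6 ℕ.* a ≡ m ℕ.* suc m

half : ∀ u → ∃ λ h → h ℕ.* 2 ≡ u ℕ.* suc u
half zero    = 0 ×., refl
half (suc u) = let h ×., eq = half u in suc u ℕ.+ h ×.,
  trans (ℕₚ.*-distribʳ-+ 2 (suc u) h) (trans (cong (λ x → suc u ℕ.* 2 ℕ.+ x) eq) (Solver.collect u))
  where
  module Solver where
    collect : ∀ u → suc u ℕ.* 2 ℕ.+ u ℕ.* suc u ≡ suc u ℕ.* suc (suc u)
    collect = ℕSolver.solve-∀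

-- A prime p ≥ 5 is 1 or 5 modulo 6. In the first case 3 divides m, in the second 2m - 1, so m
-- (2m-1)/3 is an integer either way.
parameters : ∀ {p} → Prime p → 5 ≤ p → Parameters p
parameters {p} p-prime 5≤p = classify (p ℕ.% 6) (p ℕ./ 6) (m≡m%n+[m/n]*n p 6) (m%n<n p 6)
  where
  no-divisor : ∀ d → 1 < d → d < 5 → ¬ (d ℕ∣.∣ p)
  no-divisor d 1<d d<5 d∣p with prime⇒irreducible p-prime d∣p
  ... | inj₁ d≡1 = ℕₚ.<⇒≢ 1<d (sym d≡1)
  ... | inj₂ d≡p = ℕₚ.<⇒≱ d<5 (ℕₚ.≤-trans 5≤p (ℕₚ.≤-reflexive (sym d≡p)))
  module Solver where
    6u   : ∀ u → 0 ℕ.+ u ℕ.* 6 ≡ u ℕ.* 3 ℕ.* 2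
    6u   = ℕSolver.solve-∀
    2+6u : ∀ u → 2 ℕ.+ u ℕ.* 6 ≡ (1 ℕ.+ u ℕ.* 3) ℕ.* 2
    2+6u = ℕSolver.solve-∀
    3+6u : ∀ u → 3 ℕ.+ u ℕ.* 6 ≡ (1 ℕ.+ u ℕ.* 2) ℕ.* 3
    3+6u = ℕSolver.solve-∀
    4+6u : ∀ u → 4 ℕ.+ u ℕ.* 6 ≡ (2 ℕ.+ u ℕ.* 3) ℕ.* 2
    4+6u = ℕSolver.solve-∀
    p₁ : ∀ u → 1 ℕ.+ u ℕ.* 6 ≡ suc ((u ℕ.+ u ℕ.+ u) ℕ.+ (u ℕ.+ u ℕ.+ u))
    p₁ = ℕSolver.solve-∀
    γ₁ : ∀ u → + 3 ℤ.* (u ℤ.* (+ 6 ℤ.* u ℤ.- 1ℤ)) ≡ (u ℤ.+ u ℤ.+ u) ℤ.* (+ 2 ℤ.* (u ℤ.+ u ℤ.+ u) ℤ.- 1ℤ)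
    γ₁ = ℤSolver.solve-∀
    a₁ : ∀ u → 6 ℕ.* (u ℕ.* u) ℕ.+ 3 ℕ.* (u ℕ.* suc u) ≡ (u ℕ.+ u ℕ.+ u) ℕ.* suc (u ℕ.+ u ℕ.+ u)
    a₁ = ℕSolver.solve-∀
    p₅ : ∀ u → 5 ℕ.+ u ℕ.* 6 ≡ suc ((2 ℕ.+ (u ℕ.+ u ℕ.+ u)) ℕ.+ (2 ℕ.+ (u ℕ.+ u ℕ.+ u)))
    p₅ = ℕSolver.solve-∀
    γ₅ : ∀ u → + 3 ℤ.* ((+ 2 ℤ.+ (u ℤ.+ u ℤ.+ u)) ℤ.* (+ 2 ℤ.* u ℤ.+ 1ℤ)) ≡
      (+ 2 ℤ.+ (u ℤ.+ u ℤ.+ u)) ℤ.* (+ 2 ℤ.* (+ 2 ℤ.+ (u ℤ.+ u ℤ.+ u)) ℤ.- 1ℤ)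
    γ₅ = ℤSolver.solve-∀
    a₅ : ∀ u → 6 ℕ.* (suc u ℕ.* suc u) ℕ.+ 3 ℕ.* (u ℕ.* suc u) ≡
        (2 ℕ.+ (u ℕ.+ u ℕ.+ u)) ℕ.* suc (2 ℕ.+ (u ℕ.+ u ℕ.+ u))
    a₅ = ℕSolver.solve-∀
    6[x+h] : ∀ x h → 6 ℕ.* (x ℕ.+ h) ≡ 6 ℕ.* x ℕ.+ 3 ℕ.* (h ℕ.* 2)
    6[x+h] = ℕSolver.solve-∀
  classify : ∀ r u → p ≡ r ℕ.+ u ℕ.* 6 → r < 6 → Parameters p
  classify 0 u eq _ = contradiction (divides (u ℕ.* 3) (trans eq (Solver.6u u)))
      (no-divisor 2 ℕₚ.≤-refl (s≤s (s≤s (s≤s z≤n))))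
  -- Here m = 3u, so a = u (3u+1)/2 = u² + u (u+1)/2, with h the triangular number.
  classify 1 u eq _ = let h ×., h*2≡ = half u in record
    { m = u ℕ.+ u ℕ.+ u ; a = u ℕ.* u ℕ.+ h ; γ = + u ℤ.* (+ 6 ℤ.* + u ℤ.- 1ℤ)
    ; p≡ = trans eq (Solver.p₁ u) ; 3γ≡ = Solver.γ₁ (+ u)
    ; 6a≡ = trans (Solver.6[x+h] (u ℕ.* u) h)
        (trans (cong (λ x → 6 ℕ.* (u ℕ.* u) ℕ.+ 3 ℕ.* x) h*2≡) (Solver.a₁ u)) }
  classify 2 u eq _ = contradiction (divides (1 ℕ.+ u ℕ.* 3) (trans eq (Solver.2+6u u)))
      (no-divisor 2 ℕₚ.≤-refl (s≤s (s≤s (s≤s z≤n))))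
  classify 3 u eq _ = contradiction (divides (1 ℕ.+ u ℕ.* 2) (trans eq (Solver.3+6u u)))
      (no-divisor 3 (s≤s (s≤s z≤n)) (s≤s (s≤s (s≤s (s≤s z≤n)))))
  classify 4 u eq _ = contradiction (divides (2 ℕ.+ u ℕ.* 3) (trans eq (Solver.4+6u u)))
      (no-divisor 2 ℕₚ.≤-refl (s≤s (s≤s (s≤s z≤n))))
  -- Here m = 3u + 2 and 2m - 1 = 3 (2u+1), so a = (u+1)(3u+2)/2 = (u+1)² + u (u+1)/2.
  classify 5 u eq _ = let h ×., h*2≡ = half u in record
    { m = 2 ℕ.+ (u ℕ.+ u ℕ.+ u) ; a = suc u ℕ.* suc u ℕ.+ h ; γ = (+ 2 ℤ.+ (+ u ℤ.+ + u ℤ.+ + u))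
        ℤ.* (+ 2 ℤ.* + u ℤ.+ 1ℤ)
    ; p≡ = trans eq (Solver.p₅ u) ; 3γ≡ = Solver.γ₅ (+ u)
    ; 6a≡ = trans (Solver.6[x+h] (suc u ℕ.* suc u) h)
        (trans (cong (λ x → 6 ℕ.* (suc u ℕ.* suc u) ℕ.+ 3 ℕ.* x) h*2≡) (Solver.a₅ u)) }
  classify (suc (suc (suc (suc (suc (suc _)))))) u eq (s≤s (s≤s (s≤s (s≤s (s≤s (s≤s ()))))))

[p²∸1]/12 : ∀ m a → 6 ℕ.* a ≡ m ℕ.* suc m → (suc (m ℕ.+ m) ℕ.^ 2 ℕ.∸ 1) ℕ./ 12 ≡ a ℕ.* 2
[p²∸1]/12 m a 6a≡ = trans (cong (λ x → (x ℕ.∸ 1) ℕ./ 12) p²≡) (m*n/n≡m (a ℕ.* 2) 12)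
  where
  open ≡-Reasoning
  module Solver where
    square : ∀ m → suc (m ℕ.+ m) ℕ.* (suc (m ℕ.+ m) ℕ.* 1) ≡ 1 ℕ.+ 4 ℕ.* (m ℕ.* suc m)
    square = ℕSolver.solve-∀
    24a : ∀ a → 1 ℕ.+ 4 ℕ.* (6 ℕ.* a) ≡ 1 ℕ.+ a ℕ.* 2 ℕ.* 12
    24a = ℕSolver.solve-∀
  p²≡ : suc (m ℕ.+ m) ℕ.^ 2 ≡ suc (a ℕ.* 2 ℕ.* 12)
  p²≡ = trans (Solver.square m) (trans (cong (λ x → 1 ℕ.+ 4 ℕ.* x) (sym 6a≡)) (Solver.24a a))

-- The q-binomial coefficient as a quotient of block products

-- The powers of 1 - q, Q^m and 1 - Q that convert factorials into block products have exponents
-- additive in s and r, so they balance. Those of 1 - Q are cancelled in ℤ[q], by their constant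
-- coefficient 1.
q-binomial-blocks : ∀ m s r → let p = suc (m ℕ.+ m); Y = prod (λ j → geo (q ^ p) j * K m j) in
  qbinom ((s ℕ.+ r) ℕ.* p) (s ℕ.* p) * (Y s * Y r) ≈ Y (s ℕ.+ r)
q-binomial-blocks m s r = *-cancelʳ Z₀≡1 (b * (Y s * Y r)) (Y (s ℕ.+ r)) (begin
  b * (Y s * Y r) * (Z ^ s * Z ^ r)
    ≈⟨ Solver.regroup b (Y s) (Y r) (Z ^ s) (Z ^ r) ⟩
  b * (Z ^ s * Y s * (Z ^ r * Y r))
    ≈⟨ *-congˡ b (*-cong (prod-blocks m s) (prod-blocks m r)) ⟨
  b * (M ^ s * D s * (M ^ r * D r))
    ≈⟨ Solver.regroup′ b (M ^ s) (D s) (M ^ r) (D r) ⟩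
  M ^ s * M ^ r * (b * (D s * D r))
    ≈⟨ *-cong (≈-sym (^-homo-* M s r)) b*D ⟩
  M ^ (s ℕ.+ r) * D (s ℕ.+ r)
    ≈⟨ prod-blocks m (s ℕ.+ r) ⟩
  Z ^ (s ℕ.+ r) * Y (s ℕ.+ r)
    ≈⟨ *-congʳ (Y (s ℕ.+ r)) (^-homo-* Z s r) ⟩
  Z ^ s * Z ^ r * Y (s ℕ.+ r)
    ≈⟨ *-comm (Z ^ s * Z ^ r) (Y (s ℕ.+ r)) ⟩
  Y (s ℕ.+ r) * (Z ^ s * Z ^ r) ∎)
  where
  open SetoidReasoning ≈-setoid
  p = suc (m ℕ.+ m)
  Q = q ^ p
  Z = 1# + - Q
  M = Q ^ m
  Y = prod (λ j → geo Q j * K m j)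
  b = qbinom ((s ℕ.+ r) ℕ.* p) (s ℕ.* p)
  D : ℕ → Poly
  D l = prod (λ i → 1# + - (q ^ i)) (l ℕ.* p)
  module Solver where
    regroup : ∀ b y y′ z z′ → b * (y * y′) * (z * z′) ≈ b * (z * y * (z′ * y′))
    regroup = solve-∀ polyRing
    regroup′ : ∀ b x d y d′ → b * (x * d * (y * d′)) ≈ x * y * (b * (d * d′))
    regroup′ = solve-∀ polyRing
  coeff₀-^ : ∀ {f} → coeff f 0 ≡ 1ℤ → ∀ l → coeff (f ^ l) 0 ≡ 1ℤ
  coeff₀-^     f₀≡1 zero    = refl
  coeff₀-^ {f} f₀≡1 (suc l) = trans (coeff₀-* f (f ^ l)) (cong₂ ℤ._*_ f₀≡1 (coeff₀-^ f₀≡1 l))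
  Q₀≡0 : coeff Q 0 ≡ 0ℤ
  Q₀≡0 = trans (coeff₀-* q (q ^ (m ℕ.+ m))) (ℤₚ.*-zeroˡ (coeff (q ^ (m ℕ.+ m)) 0))
  Z₀≡1 : coeff (Z ^ s * Z ^ r) 0 ≡ 1ℤ
  Z₀≡1 = trans (coeff₀-* (Z ^ s) (Z ^ r)) (cong₂ ℤ._*_ (coeff₀-^ z s) (coeff₀-^ z r))
    where
    z : coeff Z 0 ≡ 1ℤ
    z = trans (coeff-+ 1# (- Q) 0) (cong (λ x → 1ℤ ℤ.+ x) (trans (coeff-neg Q 0) (cong ℤ.-_ Q₀≡0)))
  F = λ l → [ l ]!q
  ω = 1# + - q
  qbinom-*p : b * (F (s ℕ.* p) * F (r ℕ.* p)) ≈ F ((s ℕ.+ r) ℕ.* p)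
  qbinom-*p = subst (λ i → qbinom i (s ℕ.* p) * (F (s ℕ.* p) * F (r ℕ.* p)) ≈ F i)
    (sym (ℕₚ.*-distribʳ-+ p s r)) (qbinom-! (s ℕ.* p) (r ℕ.* p))
  b*D : b * (D s * D r) ≈ D (s ℕ.+ r)
  b*D = begin
    b * (D s * D r)
      ≈⟨ *-congˡ b (*-cong ([]!q≈prod (s ℕ.* p)) ([]!q≈prod (r ℕ.* p))) ⟨
    b * (ω ^ (s ℕ.* p) * F (s ℕ.* p) * (ω ^ (r ℕ.* p) * F (r ℕ.* p)))
      ≈⟨ Solver.regroup′ b (ω ^ (s ℕ.* p)) (F (s ℕ.* p)) (ω ^ (r ℕ.* p)) (F (r ℕ.* p)) ⟩
    ω ^ (s ℕ.* p) * ω ^ (r ℕ.* p) * (b * (F (s ℕ.* p) * F (r ℕ.* p)))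
      ≈⟨ *-cong (≈-sym (^-homo-* ω (s ℕ.* p) (r ℕ.* p))) qbinom-*p ⟩
    ω ^ (s ℕ.* p ℕ.+ r ℕ.* p) * F ((s ℕ.+ r) ℕ.* p)
      ≡⟨ cong (λ i → ω ^ i * F ((s ℕ.+ r) ℕ.* p)) (sym (ℕₚ.*-distribʳ-+ p s r)) ⟩
    ω ^ ((s ℕ.+ r) ℕ.* p) * F ((s ℕ.+ r) ℕ.* p)
      ≈⟨ []!q≈prod ((s ℕ.+ r) ℕ.* p) ⟩
    D (s ℕ.+ r) ∎

-- A case of Vandermonde's identity; its mixed term s r becomes the correction term of the theorem.
binom-2-+ : ∀ s r → binom (s ℕ.+ r) 2 ≡ binom s 2 ℤ.+ binom r 2 ℤ.+ + s ℤ.* + r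
binom-2-+ zero    r = sym (trans (cong (λ x → 0ℤ ℤ.+ binom r 2 ℤ.+ x) (ℤₚ.*-zeroˡ (+ r)))
  (trans (ℤₚ.+-identityʳ _) (ℤₚ.+-identityˡ (binom r 2))))
binom-2-+ (suc s) r = trans (cong₂ ℤ._+_ (binom-1 (s ℕ.+ r)) (binom-2-+ s r))
  (trans (Solver.collect (+ s) (+ r) (binom s 2) (binom r 2))
    (cong (λ x → x ℤ.+ binom s 2 ℤ.+ binom r 2 ℤ.+ (1ℤ ℤ.+ + s) ℤ.* + r) (sym (binom-1 s))))
  where
  module Solver where
    collect : ∀ s r x y → s ℤ.+ r ℤ.+ (x ℤ.+ y ℤ.+ s ℤ.* r) ≡ s ℤ.+ x ℤ.+ y ℤ.+ (1ℤ ℤ.+ s) ℤ.* r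
    collect = ℤSolver.solve-∀

-- Cancellation, and the congruence for k = s + r

module _ (m : ℕ) (p-prime : Prime (suc (m ℕ.+ m))) (γ : ℤ) (a : ℕ)
  (3γ≡ : + 3 ℤ.* γ ≡ + m ℤ.* (+ 2 ℤ.* + m ℤ.- 1ℤ)) (6a≡ : 6 ℕ.* a ≡ m ℕ.* suc m) where

  private
    6a≡ℤ : + 6 ℤ.* + a ≡ + m ℤ.* (+ m ℤ.+ 1ℤ)
    6a≡ℤ = trans (sym (ℤₚ.pos-* 6 a)) (trans (cong +_ 6a≡)
      (trans (ℤₚ.pos-* m (suc m)) (cong (λ x → + m ℤ.* + x) (ℕₚ.+-comm 1 m))))

  open PrimeModulus (m ℕ.+ m) p-prime using (p; φ; φ₀≡1; q^p≋1)
  open Blocks m p-prime γ (+ a) 3γ≡ 6a≡ℤ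

  T≋1 : T Modφ.≋ 1#
  T≋1 = Modφ.≋-trans (Modφ.≋-^ p q^p≋1) (Modφ.≈⇒≋ (1^n≈1 p))

  U : ℕ → Poly
  U = prod (geo T)

  U≋! : ∀ l → U l Modφ.≋ const (+ (l !))
  U≋! zero    = Modφ.≋-refl
  U≋! (suc l) = begin
    geo T (suc l) * U l             ≈⟨ Modφ.≋-* (geo-≋-const T≋1 (suc l)) (U≋! l) ⟩
    const (+ suc l) * const (+ (l !)) ≈⟨ Modφ.≈⇒≋ (const-* (+ suc l) (+ (l !))) ⟨
    const (+ suc l ℤ.* + (l !))     ≡⟨ cong const (ℤₚ.pos-* (suc l) (l !)) ⟨
    const (+ (suc l !))             ∎
    where open SetoidReasoning Modφ.≋-setoid

  regular-U : ∀ l → Regular φ (U l)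
  regular-U l = regular-resp (Modφ.≋-sym (U≋! l)) (regular-const φ₀≡1 (+ (l !)) {{l ℕₚ.!≢0}})

  regular-E^ : ∀ l → Regular φ ((e₀ * M) ^ l)
  regular-E^ zero    = regular-1
  regular-E^ (suc l) = regular-* (regular-resp (Modφ.≋-sym E≋p) (regular-const φ₀≡1 (+ p))) (regular-E^ l)
    where
    open SetoidReasoning Modφ.≋-setoid
    E≋p : e₀ * M Modφ.≋ const (+ p)
    E≋p = begin
      e₀ * M               ≈⟨ Modφ.≋-* e₀≋p (Modφ.≋-trans (Modφ.≋-^ m q^p≋1) (Modφ.≈⇒≋ (1^n≈1 m))) ⟩
      const (+ p) * 1#     ≈⟨ Modφ.≈⇒≋ (≈-trans (*-comm (const (+ p)) 1#) (*-identityˡ (const (+ p)))) ⟩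
      const (+ p)          ∎

  -- 1 - x t² has the inverse 1 + x t² because t⁴ ≡ 0, so it is a unit modulo [p]³ already.
  regular-Ψ : ∀ l → Regular Φ (Ψ l)
  regular-Ψ l = regular-unit (Ψ l) (1# + const (+ a ℤ.* binom l 2) * (t * t))
    (jet-unique refl refl (Solver.inverse (+ a ℤ.* binom l 2))
      (jet-* (jet-Ψ l) (jet-+ (jet-const 1ℤ) (jet-const*t² (+ a ℤ.* binom l 2)))) (jet-const 1ℤ))
    where
    module Solver where
      inverse : ∀ x → 1ℤ ℤ.* (0ℤ ℤ.+ x) ℤ.+ 0ℤ ℤ.* 0ℤ ℤ.+ ℤ.- x ℤ.* 1ℤ ≡ 0ℤ
      inverse = ℤSolver.solve-∀

  module _ (s r : ℕ) where

    private
      k = s ℕ.+ r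
      b = qbinom (k ℕ.* p) (s ℕ.* p)

    β : Poly
    β = qbinom k s [q↦ T ]

    β*U : β * (U s * U r) ≈ U k
    β*U = begin
      β * (U s * U r)
        ≈⟨ *-congˡ β (*-cong ([↦]-!q s T) ([↦]-!q r T)) ⟨
      β * ([ s ]!q [q↦ T ] * [ r ]!q [q↦ T ])
        ≈⟨ *-congˡ β ([↦]-* [ s ]!q [ r ]!q T) ⟨
      β * ([ s ]!q * [ r ]!q) [q↦ T ]
        ≈⟨ [↦]-* (qbinom k s) ([ s ]!q * [ r ]!q) T ⟨
      (qbinom k s * ([ s ]!q * [ r ]!q)) [q↦ T ]
        ≈⟨ [↦]-cong T (qbinom-! s r) ⟩
      [ k ]!q [q↦ T ]
        ≈⟨ [↦]-!q k T ⟩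
      U k ∎
      where open SetoidReasoning ≈-setoid

    -- As Q^p ≡ 1, the factorial equation of `β` reduces to that of C(k,s), and s! r! is regular
    -- modulo [p].
    β≋C : β Modφ.≋ const (+ (k C s))
    β≋C = regular-cancel (regular-* (regular-U s) (regular-U r)) β (const (+ (k C s))) (begin
      U s * U r * β
        ≈⟨ Modφ.≈⇒≋ (*-comm (U s * U r) β) ⟩
      β * (U s * U r)
        ≈⟨ Modφ.≈⇒≋ β*U ⟩
      U k
        ≈⟨ U≋! k ⟩
      const (+ (k !))
        ≡⟨ cong (λ x → const (+ x)) (C-! s r) ⟨
      const (+ ((k C s) ℕ.* (s ! ℕ.* r !)))
        ≡⟨ cong const (trans (ℤₚ.pos-* (k C s) (s ! ℕ.* r !))
            (cong (λ x → + (k C s) ℤ.* x) (ℤₚ.pos-* (s !) (r !)))) ⟩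
      const (+ (k C s) ℤ.* (+ (s !) ℤ.* + (r !)))
        ≈⟨ Modφ.≈⇒≋ (≈-trans (const-* (+ (k C s)) (+ (s !) ℤ.* + (r !)))
            (*-congˡ (const (+ (k C s))) (const-* (+ (s !)) (+ (r !))))) ⟩
      const (+ (k C s)) * (const (+ (s !)) * const (+ (r !)))
        ≈⟨ Modφ.≋-*ˡ (const (+ (k C s))) (Modφ.≋-* (U≋! s) (U≋! r)) ⟨
      const (+ (k C s)) * (U s * U r)
        ≈⟨ Modφ.≈⇒≋ (*-comm (const (+ (k C s))) (U s * U r)) ⟩
      U s * U r * const (+ (k C s)) ∎)
      where open SetoidReasoning Modφ.≋-setoid

    X : Poly
    X = 1# + - (const (+ (a ℕ.* (s ℕ.* r))) * (t * t))

    Ψ-+ : Ψ k ≋ Ψ s * Ψ r * X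
    Ψ-+ = jet-unique refl refl coefficient (jet-Ψ k) (jet-* (jet-* (jet-Ψ s) (jet-Ψ r))
      (jet-+ (jet-const 1ℤ) (jet-neg (jet-const*t² (+ (a ℕ.* (s ℕ.* r)))))))
      where
      module Solver where
        collect : ∀ a x y z → ℤ.- (a ℤ.* (x ℤ.+ y ℤ.+ z)) ≡
          1ℤ ℤ.* (0ℤ ℤ.+ ℤ.- (a ℤ.* z)) ℤ.+ 0ℤ ℤ.* 0ℤ
            ℤ.+ (1ℤ ℤ.* ℤ.- (a ℤ.* y) ℤ.+ 0ℤ ℤ.* 0ℤ ℤ.+ ℤ.- (a ℤ.* x) ℤ.* 1ℤ) ℤ.* 1ℤ
        collect = ℤSolver.solve-∀
      pos : + (a ℕ.* (s ℕ.* r)) ≡ + a ℤ.* (+ s ℤ.* + r)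
      pos = trans (ℤₚ.pos-* a (s ℕ.* r)) (cong (λ x → + a ℤ.* x) (ℤₚ.pos-* s r))
      coefficient : ℤ.- (+ a ℤ.* binom k 2) ≡
        1ℤ ℤ.* (0ℤ ℤ.+ ℤ.- (+ (a ℕ.* (s ℕ.* r)))) ℤ.+ 0ℤ ℤ.* 0ℤ
          ℤ.+ (1ℤ ℤ.* ℤ.- (+ a ℤ.* binom r 2) ℤ.+ 0ℤ ℤ.* 0ℤ ℤ.+ ℤ.- (+ a ℤ.* binom s 2) ℤ.* 1ℤ) ℤ.* 1ℤ
      coefficient = trans (cong (λ x → ℤ.- (+ a ℤ.* x)) (binom-2-+ s r))
        (trans (Solver.collect (+ a) (binom s 2) (binom r 2) (+ s ℤ.* + r))
          (cong (λ x → 1ℤ ℤ.* (0ℤ ℤ.+ ℤ.- x) ℤ.+ 0ℤ ℤ.* 0ℤ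
            ℤ.+ (1ℤ ℤ.* ℤ.- (+ a ℤ.* binom r 2) ℤ.+ 0ℤ ℤ.* 0ℤ ℤ.+ ℤ.- (+ a ℤ.* binom s 2) ℤ.* 1ℤ)
                ℤ.* 1ℤ) (sym pos)))

    -- Both sides solve the same equation once multiplied by the block products for s and r. Of the
    -- common factors, E and U are regular modulo [p] and are lifted to [p]³, while the two Ψ are
    -- units there.
    b≋βX : b ≋ β * X
    b≋βX = regular-cancel (regular-* (regular-Ψ s) (regular-Ψ r)) b (β * X)
      (regular-cancel (regular-^ φ₀≡1
          (regular-* (regular-* (regular-E^ s) (regular-E^ r)) (regular-* (regular-U s) (regular-U r))) 3)
        (Ψ s * Ψ r * b) (Ψ s * Ψ r * (β * X)) (begin
        E ^ s * E ^ r * (U s * U r) * (Ψ s * Ψ r * b)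
          ≈⟨ ≈⇒≋ (Solver.regroup b (E ^ s) (U s) (Ψ s) (E ^ r) (U r) (Ψ r)) ⟩
        b * (E ^ s * (U s * Ψ s) * (E ^ r * (U r * Ψ r)))
          ≈⟨ ≋-*ˡ b (≋-* (prod-K≋ s) (prod-K≋ r)) ⟨
        b * (prod (λ j → geo Q j * K m j) s * prod (λ j → geo Q j * K m j) r)
          ≈⟨ ≈⇒≋ (q-binomial-blocks m s r) ⟩
        prod (λ j → geo Q j * K m j) k
          ≈⟨ prod-K≋ k ⟩
        E ^ k * (U k * Ψ k)
          ≈⟨ ≋-* (≈⇒≋ (^-homo-* E s r)) (≋-* (≈⇒≋ (≈-sym β*U)) Ψ-+) ⟩
        E ^ s * E ^ r * (β * (U s * U r) * (Ψ s * Ψ r * X))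
          ≈⟨ ≈⇒≋ (Solver.regroup′ β X (E ^ s * E ^ r) (U s * U r) (Ψ s * Ψ r)) ⟩
        E ^ s * E ^ r * (U s * U r) * (Ψ s * Ψ r * (β * X)) ∎))
      where
      open SetoidReasoning ≋-setoid
      E = e₀ * M
      module Solver where
        regroup : ∀ b x u y x′ u′ y′ → x * x′ * (u * u′) * (y * y′ * b) ≈
            b * (x * (u * y) * (x′ * (u′ * y′)))
        regroup = solve-∀ polyRing
        regroup′ : ∀ β z x u y → x * (β * u * (y * z)) ≈ x * u * (y * (β * z))
        regroup′ = solve-∀ polyRing

    qbinom-congruence : b ≋ qbinom k s [q↦ q ^ (p ℕ.^ 2) ]
      - const (+ ((k C suc s) ℕ.* (suc s C 2) ℕ.* ((p ℕ.^ 2 ℕ.∸ 1) ℕ./ 12))) * (Q - 1#) ^ 2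
    qbinom-congruence = begin
      b
        ≈⟨ b≋βX ⟩
      β * X
        ≈⟨ ≈⇒≋ (Solver.expand β (const (+ asr)) t) ⟩
      β + - (const (+ asr) * (β * (t * t)))
        -- Only the copy of `β` in front of t² may be replaced by its residue modulo [p]; the
        -- leading one stays exact.
        ≈⟨ ≋-+ˡ β (≋-neg (≋-*ˡ (const (+ asr)) (≋φ⇒≋-*t² β≋C))) ⟩
      β + - (const (+ asr) * (const (+ (k C s)) * (t * t)))
        ≈⟨ ≈⇒≋ (+-cong ([↦]-congʳ (qbinom k s) T≈) (-‿cong collected)) ⟩
      qbinom k s [q↦ q ^ (p ℕ.^ 2) ] + - (const (+ coefficient) * (Q - 1#) ^ 2) ∎
      where
      open SetoidReasoning ≋-setoid
      asr = a ℕ.* (s ℕ.* r)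
      coefficient = (k C suc s) ℕ.* (suc s C 2) ℕ.* ((p ℕ.^ 2 ℕ.∸ 1) ℕ./ 12)
      module Solver where
        expand : ∀ β x t → β * (1# + - (x * (t * t))) ≈ β + - (x * (β * (t * t)))
        expand = solve-∀ polyRing
        collect : ∀ x y t → x * (y * (t * t)) ≈ y * x * (t * (t * 1#))
        collect = solve-∀ polyRing
      T≈ : T ≈ q ^ (p ℕ.^ 2)
      T≈ = ≈-trans (^-assocʳ q p p) (CommutativeRing.reflexive ℤ[q]
          (cong (λ x → q ^ (p ℕ.* x)) (sym (ℕₚ.*-identityʳ p))))
      coefficient≡ : (k C s) ℕ.* asr ≡ coefficient
      coefficient≡ = trans (sym (C-product s r a))
          (cong ((k C suc s) ℕ.* (suc s C 2) ℕ.*_) (sym ([p²∸1]/12 m a 6a≡)))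
      collected : const (+ asr) * (const (+ (k C s)) * (t * t)) ≈ const (+ coefficient) * (Q - 1#) ^ 2
      collected = ≈-trans (Solver.collect (const (+ asr)) (const (+ (k C s))) t)
        (*-congʳ (t * (t * 1#)) (≈-trans (≈-sym (const-* (+ (k C s)) (+ asr)))
          (CommutativeRing.reflexive ℤ[q]
              (cong const (trans (sym (ℤₚ.pos-* (k C s) asr)) (cong +_ coefficient≡))))))

-- The theorem for all k and s

private
  RHS : ℕ → ℕ → ℕ → Poly
  RHS p k s = qbinom k s [q↦ q ^ (p ℕ.^ 2) ]
    - const (+ ((k C suc s) ℕ.* (suc s C 2) ℕ.* ((p ℕ.^ 2 ∸ 1) / 12))) * (q ^ p - 1#) ^ 2

congruence-≤ : ∀ {p k s} → Prime p → Parameters p → s ≤ k →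
  qbinom (k ℕ.* p) (s ℕ.* p) ≡ RHS p k s [mod [ p ]q ^ 3 ]
congruence-≤ {p} {k} {s} p-prime record { m = m ; a = a ; γ = γ ; p≡ = refl ; 3γ≡ = 3γ≡ ; 6a≡ = 6a≡ } s≤k =
  subst (λ f → qbinom (k ℕ.* p) (s ℕ.* p) ≡ RHS p k s [mod f ^ 3 ]) (sym ([]q≡geo p))
    (subst (λ k → qbinom (k ℕ.* p) (s ℕ.* p) ≡ RHS p k s [mod geo q p ^ 3 ]) (ℕₚ.m+[n∸m]≡n s≤k)
      (Congruence.≋⇒∣ (geo q p ^ 3) (qbinom-congruence m p-prime γ a 3γ≡ 6a≡ s (k ∸ s))))

-- Everything vanishes: both q-binomial coefficients, and the correction because C(k,s+1) = 0.
congruence-> : ∀ {p k s} → Prime p → k < s →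
  qbinom (k ℕ.* p) (s ℕ.* p) ≡ RHS p k s [mod [ p ]q ^ 3 ]
congruence-> {p} {k} {s} p-prime k<s = Congruence.≋⇒∣ ([ p ]q ^ 3) (Congruence.≈⇒≋ ([ p ]q ^ 3) (begin
  qbinom (k ℕ.* p) (s ℕ.* p)
    ≈⟨ qbinom-zero (ℕₚ.*-monoˡ-< p {{prime⇒nonZero p-prime}} k<s) ⟩
  0#
    ≈⟨ +-cong ([↦]-zero (q ^ (p ℕ.^ 2)) (qbinom-zero k<s))
        (-‿cong (*-≈0ˡ ((q ^ p - 1#) ^ 2) coefficient≈0)) ⟨
  RHS p k s ∎))
  where
  open SetoidReasoning ≈-setoid
  coefficient≈0 : const (+ ((k C suc s) ℕ.* (suc s C 2) ℕ.* ((p ℕ.^ 2 ∸ 1) / 12))) ≈ 0#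
  coefficient≈0 = ≈-trans (CommutativeRing.reflexive ℤ[q]
    (cong (λ x → const (+ (x ℕ.* (suc s C 2) ℕ.* ((p ℕ.^ 2 ∸ 1) / 12))))
        (k>n⇒nCk≡0 (ℕₚ.m<n⇒m<1+n k<s)))) 0∷[]≈[]

theorem3 : ∀ (p : ℕ) → Prime p → 5 ≤ p → ∀ (k s : ℕ) →
    qbinom (k ℕ.* p) (s ℕ.* p) ≡
    qbinom k s [q↦ q ^ (p ℕ.^ 2) ]
    - const (+ ((k C suc s) ℕ.* (suc s C 2) ℕ.* ((p ℕ.^ 2 ∸ 1) / 12))) * (q ^ p - 1#) ^ 2
    [mod [ p ]q ^ 3 ]
theorem3 p p-prime 5≤p k s =
  [ congruence-≤ p-prime (parameters p-prime 5≤p) , congruence-> p-prime ]′ (ℕₚ.≤-<-connex s k)
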